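{- Let $P_n = C_2 \times C_n$ be the Catalan poset on $2n$ elements. Then its sorting probability satisfies $\delta(P_n) = O\bigl(n^{ -5/4}\bigr)$ as $n \to \infty$; that is, there exist constants $C>0$ and $N$ such that $\delta(P_n) \le C\, n^{ -5/4}$ for all $n \ge N$.
   Context: $C_k$ denotes the chain with $k$ elements, and $P_n=C_2\times C_n$ is the product poset: its elements are the cells $(i,j)$ with $i\in\{1,2\}$, $j\in\{1,\dots,n\}$, ordered by $(i,j)\preceq(i',j')$ iff $i\le i'$ and $j\le j'$. For a finite poset $P=(X,\prec)$, a linear extension is an order-preserving bijection $L: X\to\{1,\dots,|X|\}$; let $\mathcal L_P$ be the set of linear extensions and let $L$ be chosen uniformly at random from $\mathcal L_P$. The sorting probability is $$\delta(P) := \min_{x,y\in X,\ x\ne y} \bigl|\, \mathbf P[L(x)\le L(y)] - \mathbf P[L(y)\le L(x)]\,\bigr|.$$ -}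

module Defs where

open import Data.Nat using (ℕ; zero; suc; _*_; _≤_; ∣_-_∣)
open import Data.Nat.Properties using (_≤?_)
open import Data.Fin using (Fin; toℕ; combine)
open import Data.Fin.Properties using (all?; any?) renaming (_≟_ to _≟F_)
open import Data.Product using (_×_; ∃; _,_)
open import Data.Product.Properties using () renaming (≡-dec to ×-≡-dec)
open import Data.Vec using (Vec; []; _∷_; lookup)
open import Data.List using (List; []; _∷_; map; concatMap; allFin; filter; length)
open import Relation.Nullary using (Dec; yes; no; _×-dec_)
open import Relation.Unary using (Decidable)
open import Data.Empty using (⊥-elim)
open import Relation.Binary.PropositionalEquality using (_≡_)

Cell : ℕ → Set
Cell n = Fin 2 × Fin n

_≼_ : ∀ {n} → Cell n → Cell n → Set
(i , j) ≼ (i' , j') = (toℕ i ≤ toℕ i') × (toℕ j ≤ toℕ j')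

_≼?_ : ∀ {n} (x y : Cell n) → Dec (x ≼ y)
(i , j) ≼? (i' , j') = (toℕ i ≤? toℕ i') ×-dec (toℕ j ≤? toℕ j')

-- A map X → {0,…,2n-1} (positions 0-indexed) is encoded by the vector of its
-- values, the cell (i , j) being stored at index  combine i j.
Map : ℕ → Set
Map n = Vec (Fin (2 * n)) (2 * n)

app : ∀ n → Map n → Cell n → Fin (2 * n)
app n v (i , j) = lookup v (combine i j)

allVecs : ∀ k m → List (Vec (Fin m) k)
allVecs zero    m = [] ∷ []
allVecs (suc k) m = concatMap (λ a → map (a ∷_) (allVecs k m)) (allFin m)

IsBijection : ∀ {n} → Map n → Set
IsBijection {n} v =
  (∀ (x y : Cell n) → app n v x ≡ app n v y → x ≡ y) × (∀ (k : Fin (2 * n)) → ∃ λ (x : Cell n) → app n v x ≡ k)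

IsOrderPreserving : ∀ {n} → Map n → Set
IsOrderPreserving {n} v = ∀ (x y : Cell n) → _≼_ {n} x y → toℕ (app n v x) ≤ toℕ (app n v y)

IsLinExt : ∀ {n} → Map n → Set
IsLinExt {n} v = IsBijection {n} v × IsOrderPreserving {n} v

private
  →-dec : ∀ {a b} {A : Set a} {B : Set b} → Dec A → Dec B → Dec (A → B)
  →-dec (yes a) (yes b) = yes (λ _ → b)
  →-dec (yes a) (no ¬b) = no (λ f → ¬b (f a))
  →-dec (no ¬a) _          = yes (λ a → ⊥-elim (¬a a))

  cell-all? : ∀ {n} {P : Cell n → Set} → (∀ x → Dec (P x)) → Dec (∀ x → P x)
  cell-all? {P = P} P? with all? (λ i → all? (λ j → P? (i , j)))
  ... | yes h = yes (λ { (i , j) → h i j })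
  ... | no ¬h = no (λ h → ¬h (λ i j → h (i , j)))

  cell-any? : ∀ {n} {P : Cell n → Set} → (∀ x → Dec (P x)) → Dec (∃ P)
  cell-any? {P = P} P? with any? (λ i → any? (λ j → P? (i , j)))
  ... | yes (i , j , p) = yes ((i , j) , p)
  ... | no ¬h = no (λ { ((i , j) , p) → ¬h (i , j , p) })

  _≟C_ : ∀ {n} (x y : Cell n) → Dec (x ≡ y)
  _≟C_ = ×-≡-dec _≟F_ _≟F_

isLinExt? : ∀ {n} → Decidable (IsLinExt {n})
isLinExt? {n} v =
  (cell-all? (λ x → cell-all? (λ y → →-dec (app n v x ≟F app n v y) (_≟C_ {n} x y)))
    ×-dec all? (λ k → cell-any? (λ x → app n v x ≟F k)))
  ×-dec cell-all? (λ x → cell-all? (λ y → →-dec (_≼?_ {n} x y) (toℕ (app n v x) ≤? toℕ (app n v y))))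

linExts : ∀ n → List (Map n)
linExts n = filter (isLinExt? {n}) (allVecs (2 * n) (2 * n))

numLinExt : ℕ → ℕ
numLinExt n = length (linExts n)

numBefore : ∀ n → Cell n → Cell n → ℕ
numBefore n x y = length (filter (λ v → toℕ (app n v x) ≤? toℕ (app n v y)) (linExts n))

-- |P[L(x) ≤ L(y)] − P[L(y) ≤ L(x)]| = bias n x y / numLinExt n.
bias : ∀ n → Cell n → Cell n → ℕ
bias n x y = ∣ numBefore n x y - numBefore n y x ∣

{-# OPTIONS --safe #-}
-- A linear extension of C₂ × Cₙ is a Dyck path of length 2n: the k-th step is up or down according
-- to the row of the cell labelled k.  Numbering the columns from 0, put m = α + β + 1 and
-- k = α - β + 1; then (2 , β) precedes (1 , α) iff the path has height less than k at time m, so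
-- the number of such paths has to be brought close to half of the Catalan number e.
--
-- Let k be the median height at time n, which is of order √n.  Keep k fixed and replace n by the
-- times n + 2i.  By the product formulas for ballot numbers, the number X i of paths that are
-- below k at time n + 2i satisfies
--     X (i + 1) - X i = f (k - 1) (k + 1) t / (k (n² - t²)),   t = 2i + 1,
-- where f counts the paths through height k - 1 at time n + t.  As f k ≤ 6e, each increment is
-- O(e t / n²).  As long as i is O(n^(3/4)), f stays above half of its value at i = 0, and over such
-- a range the increments add up to more than the number of paths at height k at time n.  So X
-- crosses e/2 at some i = O(n^(3/4)), and the increment there is O(e n^(-5/4)).
module Submission where

open import Defs
open import Data.Nat
open import Data.Nat.Properties
open import Data.Nat.Tactic.RingSolver using (solve; solve-∀)
open import Data.List using (List; []; _∷_; map; filter; length; _++_; concatMap; allFin; cartesianProductWith)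
open import Data.Product using (_×_; _,_; proj₁; proj₂; ∃-syntax)
open import Data.Sum using (_⊎_; inj₁; inj₂)
open import Function using (_∘_; _⇔_; Equivalence; mk⇔)
open import Level using (0ℓ)
open import Relation.Nullary using (Dec; yes; no; does; ¬_; contradiction)
open import Relation.Nullary.Decidable using (dec-true; dec-false)
open import Relation.Unary using (Pred; Decidable)
open import Relation.Binary.PropositionalEquality

-- Ballot numbers

-- Linear combinations: the side identity a + p ≡ b + q (plus slack r) is left to the ring solver.
≡-by : ∀ {a b p q} → p ≡ q → a + p ≡ b + q → a ≡ b
≡-by {a} {b} {p} refl eq = +-cancelʳ-≡ p a b eq

≤-by : ∀ {a b p q} → p ≤ q → ∀ r → a + q + r ≡ b + p → a ≤ b
≤-by {a} {b} {p} {q} p≤q r eq =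
  +-cancelʳ-≤ q a b (≤-trans (≤-trans (m≤m+n (a + q) r) (≤-reflexive eq)) (+-monoʳ-≤ b p≤q))

≤-slack : ∀ {a b} r → a + r ≡ b → a ≤ b
≤-slack {a} r refl = m≤m+n a r

-- *-monoʳ-≤ with a type the ring solver can read.
scale-≤ : ∀ {a b} k → a ≤ b → k * a ≤ k * b
scale-≤ k = *-monoʳ-≤ k

transfer : (ℕ → ℕ) → ℕ → ℕ
transfer φ zero    = φ 1
transfer φ (suc x) = φ (2 + x) + φ x

-- The number of nonnegative ±1 paths of length m from 0 to x, or equivalently from x to 0.
ballot : ℕ → ℕ → ℕ
ballot zero    zero    = 1
ballot zero    (suc _) = 0
ballot (suc m) x       = transfer (ballot m) x

ballot-above : ∀ m x → m < x → ballot m x ≡ 0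
ballot-above zero    (suc x) _         = refl
ballot-above (suc m) (suc x) (s≤s m<x) =
  cong₂ _+_ (ballot-above m (2 + x) (m≤n⇒m≤1+n (m≤n⇒m≤1+n m<x))) (ballot-above m x m<x)

ballot-odd : ∀ m x c → m + x ≡ 1 + 2 * c → ballot m x ≡ 0
ballot-odd zero    (suc x) c       eq = refl
ballot-odd (suc m) zero    c       eq = ballot-odd m 1 c (trans (+-suc m 0) eq)
ballot-odd (suc m) (suc x) zero    eq with () ← trans (sym (+-suc m x)) (suc-injective eq)
ballot-odd (suc m) (suc x) (suc c) eq =
  cong₂ _+_ (ballot-odd m (2 + x) (suc c) (trans (+-suc m (suc x)) eq))
            (ballot-odd m x c (suc-injective (suc-injective (trans (cong suc (sym (+-suc m x))) (trans eq (lemma c))))))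
  where
  lemma : ∀ c → 1 + 2 * suc c ≡ 2 + (1 + 2 * c)
  lemma = solve-∀

ballot-mono-2 : ∀ m x → ballot m x ≤ ballot (2 + m) x
ballot-mono-2 m zero    = m≤n+m (ballot m 0) (ballot m 2)
ballot-mono-2 m (suc x) = ≤-trans (m≤n+m _ _) (m≤m+n (ballot m (3 + x) + ballot m (1 + x)) _)

-- Each of these equates two products of linear factors with neighbouring ballot numbers,
-- written additively to avoid the factors n - x and s - h.
mutual
  ballot-same-time : ∀ n x →
    (x + 1) * (n + x + 4) * ballot n (2 + x) + (x + 3) * x * ballot n x ≡ (x + 3) * n * ballot n x
  ballot-same-time zero    zero    = refl
  ballot-same-time zero    (suc x) = lemma ((suc x + 1) * (suc x + 4)) ((suc x + 3) * suc x) ((suc x + 3) * 0)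
    where
    lemma : ∀ a b c → a * 0 + b * 0 ≡ c * 0
    lemma = solve-∀
  ballot-same-time (suc n) x =
    -- At time `suc n` the counts at heights `x` and `2 + x` are both proportional to
    -- `ballot n (suc x)`. Eliminating it leaves a common factor x + 2.
    *-cancelˡ-≡ _ _ (suc (suc x))
      (lemma (ballot n (suc x)) (ballot (suc n) x) (ballot (suc n) (2 + x)) (ballot-down n x) (ballot-up n (suc x)))
    where
    lemma : ∀ a b c →
      2 * (x + 1) * (n + 1) * a + (x + 2) * x * b ≡ (x + 2) * (n + 1) * b →
      2 * (suc x + 2) * (n + 1) * a ≡ (suc x + 1) * (n + suc x + 4) * c →
      suc (suc x) * ((x + 1) * (suc n + x + 4) * c + (x + 3) * x * b) ≡ suc (suc x) * ((x + 3) * suc n * b)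
    lemma a b c d u = ≡-by (cong₂ _+_ (cong ((x + 3) *_) (sym d)) (cong ((x + 1) *_) u))
      (solve (x ∷ n ∷ a ∷ b ∷ c ∷ []))

  ballot-up : ∀ s h →
    2 * (h + 2) * (s + 1) * ballot s h ≡ (h + 1) * (s + h + 4) * ballot (suc s) (suc h)
  ballot-up s h = lemma (ballot s h) (ballot s (2 + h)) (ballot-same-time s h)
    where
    lemma : ∀ a b →
      (h + 1) * (s + h + 4) * b + (h + 3) * h * a ≡ (h + 3) * s * a →
      2 * (h + 2) * (s + 1) * a ≡ (h + 1) * (s + h + 4) * (b + a)
    lemma a b eq = ≡-by eq (solve (h ∷ s ∷ a ∷ b ∷ []))

  ballot-down : ∀ s h →
    2 * (h + 1) * (s + 1) * ballot s (suc h) + (h + 2) * h * ballot (suc s) h ≡ (h + 2) * (s + 1) * ballot (suc s) h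
  ballot-down s zero    = lemma s (ballot s 1)
    where
    lemma : ∀ s a → 2 * (0 + 1) * (s + 1) * a + (0 + 2) * 0 * a ≡ (0 + 2) * (s + 1) * a
    lemma = solve-∀
  ballot-down s (suc g) = lemma (ballot s g) (ballot s (2 + g)) (ballot-same-time s g)
    where
    lemma : ∀ a b →
      (g + 1) * (s + g + 4) * b + (g + 3) * g * a ≡ (g + 3) * s * a →
      2 * (suc g + 1) * (s + 1) * b + (suc g + 2) * suc g * (b + a) ≡ (suc g + 2) * (s + 1) * (b + a)
    lemma a b eq = ≡-by (sym eq) (solve (g ∷ s ∷ a ∷ b ∷ []))

-- Compose `ballot-up` to height h + 1 with `ballot-down` back to h. The factor (s + 3)² - (h + 1)²
-- is (s + h + 4)(s - h + 2).
ballot-two-steps : ∀ s h →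
  4 * (s + 1) * (s + 2) * ballot s h + (h + 1) * (h + 1) * ballot (2 + s) h ≡ (s + 3) * (s + 3) * ballot (2 + s) h
ballot-two-steps s h =
  *-cancelˡ-≡ _ _ (suc h * suc (suc h))
    (lemma (ballot s h) (ballot (suc s) (suc h)) (ballot (2 + s) h) (ballot-up s h) (ballot-down (suc s) h))
  where
  lemma : ∀ a b c →
    2 * (h + 2) * (s + 1) * a ≡ (h + 1) * (s + h + 4) * b →
    2 * (h + 1) * (suc s + 1) * b + (h + 2) * h * c ≡ (h + 2) * (suc s + 1) * c →
    suc h * suc (suc h) * (4 * (s + 1) * (s + 2) * a + (h + 1) * (h + 1) * c) ≡
    suc h * suc (suc h) * ((s + 3) * (s + 3) * c)
  lemma a b c u d =
    ≡-by (cong₂ _+_ (cong (2 * (h + 1) * (s + 2) *_) (sym u)) (cong ((h + 1) * (s + h + 4) *_) (sym d)))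
      (solve (h ∷ s ∷ a ∷ b ∷ c ∷ []))

-- Since n - x ≤ n + x + 4 in `ballot-same-time`, the quotient of `ballot n x` by x + 1 never grows
-- along a parity class.
ballot-ratio-upper : ∀ n x → ballot n (2 + x) * (x + 1) ≤ ballot n x * (x + 3)
ballot-ratio-upper n x =
  *-cancelˡ-≤ (suc (suc (suc (suc (n + x))))) (lemma (ballot n x) (ballot n (2 + x)) (ballot-same-time n x))
  where
  lemma : ∀ a b → (x + 1) * (n + x + 4) * b + (x + 3) * x * a ≡ (x + 3) * n * a →
    suc (suc (suc (suc (n + x)))) * (b * (x + 1)) ≤ suc (suc (suc (suc (n + x)))) * (a * (x + 3))
  lemma a b eq = ≤-by (≤-reflexive eq) ((x + 3) * a * (2 * x + 4)) (solve (n ∷ x ∷ a ∷ b ∷ []))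

-- In `ballot-same-time`, (x + 3)(n - x) exceeds (x + 1)(n + x + 4) by 2n - 2(x + 2)² + 4, so the
-- counts rise up to height about √n.
ballot-increasing : ∀ n x → (2 + x) * (2 + x) ≤ n → ballot n x ≤ ballot n (2 + x)
ballot-increasing n x le =
  -- This is (x + 1)(n + x + 4), written as a successor so that it is visibly nonzero.
  *-cancelˡ-≤ (suc (x * (n + x + 4) + n + x + 3)) (lemma (ballot n x) (ballot n (2 + x)) (ballot-same-time n x))
  where
  lemma : ∀ a b → (x + 1) * (n + x + 4) * b + (x + 3) * x * a ≡ (x + 3) * n * a →
    suc (x * (n + x + 4) + n + x + 3) * a ≤ suc (x * (n + x + 4) + n + x + 3) * b
  lemma a b eq =
    ≤-by (+-mono-≤ (≤-reflexive (sym eq)) (scale-≤ (2 * a) le)) (4 * a)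
      (solve (n ∷ x ∷ a ∷ b ∷ []))

-- Finite sums and self-adjointness of the transfer operator

sum< : ℕ → (ℕ → ℕ) → ℕ
sum< zero    f = 0
sum< (suc k) f = sum< k f + f k

sum<-mono-≤ : ∀ k {f g} → (∀ x → x < k → f x ≤ g x) → sum< k f ≤ sum< k g
sum<-mono-≤ zero    le = z≤n
sum<-mono-≤ (suc k) le = +-mono-≤ (sum<-mono-≤ k (λ x x<k → le x (m≤n⇒m≤1+n x<k))) (le k ≤-refl)

sum<-cong : ∀ k {f g} → (∀ x → x < k → f x ≡ g x) → sum< k f ≡ sum< k g
sum<-cong zero    eq = refl
sum<-cong (suc k) eq = cong₂ _+_ (sum<-cong k (λ x x<k → eq x (m≤n⇒m≤1+n x<k))) (eq k ≤-refl)

sum<-split : ∀ j k f → sum< (j + k) f ≡ sum< k f + sum< j (λ x → f (x + k))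
sum<-split zero    k f = sym (+-identityʳ _)
sum<-split (suc j) k f = trans (cong (_+ f (j + k)) (sum<-split j k f)) (+-assoc (sum< k f) _ _)

sum<-≤ : ∀ {j k} f → j ≤ k → sum< j f ≤ sum< k f
sum<-≤ {j} {k} f j≤k = subst (λ i → sum< j f ≤ sum< i f) (m∸n+n≡m j≤k)
  (≤-trans (m≤m+n _ _) (≤-reflexive (sym (sum<-split (k ∸ j) j f))))

sum<-stable : ∀ {j k} f → j ≤ k → (∀ x → j ≤ x → f x ≡ 0) → sum< k f ≡ sum< j f
sum<-stable {j} {k} f j≤k f≡0 = trans (cong (λ i → sum< i f) (sym (m∸n+n≡m j≤k))) (go (k ∸ j))
  where
  go : ∀ i → sum< (i + j) f ≡ sum< j f
  go zero    = refl
  go (suc i) = trans (cong₂ _+_ (go i) (f≡0 (i + j) (m≤n+m j i))) (+-identityʳ _)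

-- Summation by parts: `transfer` is symmetric, so moving it from φ to `ballot A` changes the sum
-- only by the two edges that cross the cutoff, k to k + 1 and k + 1 to k + 2.
flow : ∀ A φ k →
  sum< (2 + k) (λ x → ballot A x * transfer φ x) ≡
  sum< (1 + k) (λ x → ballot (suc A) x * φ x) + ballot A (suc k) * φ (2 + k) + ballot A k * φ (suc k)
flow A φ zero    = lemma (ballot A 0) (ballot A 1) (φ 0) (φ 1) (φ 2)
  where
  lemma : ∀ a b x y z → 0 + a * y + b * (z + x) ≡ 0 + b * x + b * z + a * y
  lemma = solve-∀
flow A φ (suc k) =
  lemma (flow A φ k)
  where
  lemma : ∀ {S T} → S ≡ T + ballot A (suc k) * φ (2 + k) + ballot A k * φ (suc k) →
    S + ballot A (2 + k) * (φ (3 + k) + φ (suc k)) ≡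
    T + (ballot A (2 + k) + ballot A k) * φ (suc k) + ballot A (2 + k) * φ (3 + k) + ballot A (suc k) * φ (2 + k)
  lemma {T = T} refl = arith T (ballot A k) (ballot A (suc k)) (ballot A (2 + k)) (φ (suc k)) (φ (2 + k)) (φ (3 + k))
    where
    arith : ∀ T a b c x y z → T + b * y + a * x + c * (z + x) ≡ T + (c + a) * x + c * z + b * y
    arith = solve-∀

transfers : ℕ → (ℕ → ℕ) → ℕ → ℕ
transfers zero    φ x = φ x
transfers (suc m) φ x = transfer (transfers m φ) x

transfer-cong : ∀ {φ ψ} → (∀ x → φ x ≡ ψ x) → ∀ x → transfer φ x ≡ transfer ψ x
transfer-cong eq zero    = eq 1
transfer-cong eq (suc x) = cong₂ _+_ (eq (2 + x)) (eq x)

transfers-ballot : ∀ m B x → transfers m (ballot B) x ≡ ballot (m + B) x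
transfers-ballot zero    B x = refl
transfers-ballot (suc m) B x = transfer-cong (transfers-ballot m B) x

-- Iterate `flow`. The cutoff stays above the support of `ballot A`, so the boundary terms vanish at
-- every step.
transfers-sum : ∀ m A φ k → A + m ≤ k →
  sum< (m + suc k) (λ x → ballot A x * transfers m φ x) ≡ sum< (suc k) (λ x → ballot (A + m) x * φ x)
transfers-sum zero    A φ k le = cong (λ a → sum< (suc k) (λ x → ballot a x * φ x)) (sym (+-identityʳ A))
transfers-sum (suc m) A φ k le rewrite +-suc m k | +-suc A m = begin
  sum< (2 + (m + k)) (λ x → ballot A x * transfer (transfers m φ) x)
    ≡⟨ flow A (transfers m φ) (m + k) ⟩
  S + ballot A (suc (m + k)) * p + ballot A (m + k) * q
    ≡⟨ cong₂ (λ a b → S + a * p + b * q) (ballot-above A _ (m≤n⇒m≤1+n A<)) (ballot-above A _ A<) ⟩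
  S + 0 + 0
    ≡⟨ trans (+-identityʳ _) (+-identityʳ _) ⟩
  S
    ≡⟨ cong (λ j → sum< j (λ x → ballot (suc A) x * transfers m φ x)) (sym (+-suc m k)) ⟩
  sum< (m + suc k) (λ x → ballot (suc A) x * transfers m φ x)
    ≡⟨ transfers-sum m (suc A) φ k le ⟩
  sum< (suc k) (λ x → ballot (suc (A + m)) x * φ x) ∎
  where
  open ≡-Reasoning
  S = sum< (1 + (m + k)) (λ x → ballot (suc A) x * transfers m φ x)
  p = transfers m φ (2 + (m + k))
  q = transfers m φ (suc (m + k))
  A< : A < m + k
  A< = ≤-trans (≤-trans (s≤s (m≤m+n A m)) le) (m≤n+m k m)

-- The case A = 0 of `transfers-sum`, where `ballot 0` is the delta at height 0: paths are split by
-- their height at time m.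
transfers-at-0 : ∀ m φ k → m ≤ k → transfers m φ 0 ≡ sum< (suc k) (λ x → ballot m x * φ x)
transfers-at-0 m φ k m≤k = trans (sym delta) (transfers-sum m 0 φ k m≤k)
  where
  ψ = transfers m φ
  delta : sum< (m + suc k) (λ x → ballot 0 x * ψ x) ≡ ψ 0
  delta = trans (sum<-stable {1} (λ x → ballot 0 x * ψ x) (≤-trans (s≤s z≤n) (m≤n+m (suc k) m))
                  (λ { (suc x) _ → refl }))
                (+-identityʳ _)

-- Median height and drift

-- Paths of length A + B from 0 to 0 that are at height x (below, of height < k) at time A.
through : ℕ → ℕ → ℕ → ℕ
through A B x = ballot A x * ballot B x

below : ℕ → ℕ → ℕ → ℕ
below A B k = sum< k (through A B)

catalan : ℕ → ℕ
catalan n = ballot (n + n) 0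

-- No path is higher than A at time A, so a cutoff beyond A excludes nothing and every path of
-- length A + B is counted once.
below-catalan : ∀ A B k → A < k → below A B k ≡ ballot (A + B) 0
below-catalan A B (suc k) (s≤s A≤k) =
  trans (sym (transfers-at-0 A (ballot B) k A≤k)) (transfers-ballot A B 0)

below-≤ : ∀ A B k → below A B k ≤ ballot (A + B) 0
below-≤ A B k = ≤-trans (sum<-≤ (through A B) (m≤m+n k (suc A)))
  (≤-reflexive (below-catalan A B (k + suc A) (m≤n+m (suc A) k)))

through-ratio-upper : ∀ A B x →
  through A B (2 + x) * ((x + 1) * (x + 1)) ≤ through A B x * ((x + 3) * (x + 3))
through-ratio-upper A B x = lemma (ballot A x) (ballot A (2 + x)) (ballot B x) (ballot B (2 + x))
    (*-mono-≤ (ballot-ratio-upper A x) (ballot-ratio-upper B x))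
  where
  lemma : ∀ a a′ b b′ → a′ * (x + 1) * (b′ * (x + 1)) ≤ a * (x + 3) * (b * (x + 3)) →
    a′ * b′ * ((x + 1) * (x + 1)) ≤ a * b * ((x + 3) * (x + 3))
  lemma a a′ b b′ le = ≤-by le 0 (solve (x ∷ a ∷ a′ ∷ b ∷ b′ ∷ []))

-- ballot A x / (x + 1) decreases along a parity class, so through A B k dominates the squares
-- (x + 1)² for x ≤ k up to scale; these sum to (k + 1)(k + 2)(k + 3)/6.
through-below : ∀ A B k →
  through A B k * ((k + 2) * (k + 3)) ≤ 6 * (k + 1) * below A B (suc k)
through-below A B zero          = ≤-reflexive (lemma (through A B 0))
  where
  lemma : ∀ f → f * ((0 + 2) * (0 + 3)) ≡ 6 * (0 + 1) * (0 + f)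
  lemma = solve-∀
through-below A B (suc zero)    = lemma (through A B 0) (through A B 1)
  where
  lemma : ∀ f g → g * ((1 + 2) * (1 + 3)) ≤ 6 * (1 + 1) * (0 + f + g)
  lemma f g = ≤-slack (12 * f) (solve (f ∷ g ∷ []))
through-below A B (suc (suc k)) = *-cancelˡ-≤ (suc k)
    (lemma (through A B k) (through A B (2 + k)) (below A B (suc k)) (below A B (2 + k))
      (m≤m+n (below A B (suc k)) (through A B (suc k))) (through-ratio-upper A B k) (through-below A B k))
  where
  lemma : ∀ f g S T → S ≤ T → g * ((k + 1) * (k + 1)) ≤ f * ((k + 3) * (k + 3)) →
    f * ((k + 2) * (k + 3)) ≤ 6 * (k + 1) * S →
    suc k * (g * ((suc (suc k) + 2) * (suc (suc k) + 3))) ≤ suc k * (6 * (suc (suc k) + 1) * (T + g))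
  lemma f g S T S≤T ratio ih =
    ≤-by (+-mono-≤ (+-mono-≤ (scale-≤ (k + 2) ratio) (scale-≤ (k + 3) ih)) (scale-≤ (6 * (k + 1) * (k + 3)) S≤T)) 0
      (solve (k ∷ f ∷ g ∷ S ∷ T ∷ []))

-- From `through-below` and (k + 1)² ≤ (k + 2)(k + 3): a single height k carries at most a share
-- 6/(k + 1) of all paths.
through-bound : ∀ A B k → through A B k * (k + 1) ≤ 6 * ballot (A + B) 0
through-bound A B k = *-cancelˡ-≤ (suc k)
    (lemma (through A B k) (below A B (suc k)) (ballot (A + B) 0) (below-≤ A B (suc k)) (through-below A B k))
  where
  lemma : ∀ f S e → S ≤ e → f * ((k + 2) * (k + 3)) ≤ 6 * (k + 1) * S → suc k * (f * (k + 1)) ≤ suc k * (6 * e)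
  lemma f S e S≤e le = ≤-by (+-mono-≤ le (scale-≤ (6 * (k + 1)) S≤e)) (f * (3 * k + 5))
    (solve (k ∷ f ∷ S ∷ e ∷ []))

ballot-increasing-by : ∀ n x j → (x + 2 * j) * (x + 2 * j) ≤ n → ballot n x ≤ ballot n (x + 2 * j)
ballot-increasing-by n x zero    le = ≤-reflexive (cong (ballot n) (sym (+-identityʳ x)))
ballot-increasing-by n x (suc j) le =
  ≤-trans (ballot-increasing-by n x j (≤-trans (≤-slack (4 * (x + 2 * j) + 4) (square x j)) le))
    (subst (λ y → ballot n (x + 2 * j) ≤ ballot n y) (sym (shift x j))
      (ballot-increasing n (x + 2 * j) (≤-trans (≤-reflexive (square′ x j)) le)))
  where
  shift : ∀ x j → x + 2 * suc j ≡ 2 + (x + 2 * j)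
  shift = solve-∀
  square : ∀ x j → (x + 2 * j) * (x + 2 * j) + (4 * (x + 2 * j) + 4) ≡ (x + 2 * suc j) * (x + 2 * suc j)
  square = solve-∀
  square′ : ∀ x j → (2 + (x + 2 * j)) * (2 + (x + 2 * j)) ≡ (x + 2 * suc j) * (x + 2 * suc j)
  square′ = solve-∀

-- Below the mode, shifting [0, p) to [2p, 3p) preserves parity and only increases the counts.
below-small : ∀ n p → (3 * p) * (3 * p) ≤ n → 2 * below n n p ≤ catalan n
below-small n p le = begin
  2 * below n n p                                            ≡⟨ cong (below n n p +_) (+-identityʳ _) ⟩
  below n n p + below n n p                                  ≤⟨ +-mono-≤ (sum<-≤ (through n n) (m≤m+n p (p + 0))) (sum<-mono-≤ p increase) ⟩
  below n n (2 * p) + sum< p (λ x → through n n (x + 2 * p)) ≡⟨ sum<-split p (2 * p) (through n n) ⟨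
  below n n (p + 2 * p)                                      ≤⟨ below-≤ n n (p + 2 * p) ⟩
  catalan n                                                  ∎
  where
  open ≤-Reasoning
  increase : ∀ x → x < p → through n n x ≤ through n n (x + 2 * p)
  increase x x<p = *-mono-≤ up up
    where
    x+2p≤3p : x + 2 * p ≤ 3 * p
    x+2p≤3p = +-monoˡ-≤ (2 * p) (<⇒≤ x<p)
    up : ballot n x ≤ ballot n (x + 2 * p)
    up = ballot-increasing-by n x p (≤-trans (*-mono-≤ x+2p≤3p x+2p≤3p) le)

-- Beyond √(2n) the ratio of successive counts in a parity class is at most 1 - x/(2n + 4), which
-- controls the tail.
ballot-decrease : ∀ n x → 2 * n ≤ x * x →
  (4 + 2 * n) * ballot n (2 + x) + x * ballot n x ≤ (4 + 2 * n) * ballot n x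
ballot-decrease n x le with x ≤? n
... | no x≰n rewrite ballot-above n x (≰⇒> x≰n) | ballot-above n (2 + x) (m≤n⇒m≤1+n (m≤n⇒m≤1+n (≰⇒> x≰n))) =
  ≤-reflexive (lemma (4 + 2 * n) x)
  where
  lemma : ∀ a b → a * 0 + b * 0 ≡ a * 0
  lemma = solve-∀
-- First 2n ≤ x² bounds the exact ratio by (n + 4)/(n + x + 4). Then x ≤ n and b ≤ a let the
-- denominator grow to 4 + 2n.
... | yes x≤n = combine (ballot n x) (ballot n (2 + x)) sharp
  where
  lemma : ∀ a b → (x + 1) * (n + x + 4) * b + (x + 3) * x * a ≡ (x + 3) * n * a →
    suc x * ((n + x + 4) * b + x * a) ≤ suc x * ((n + x + 4) * a)
  lemma a b eq = ≤-by (+-mono-≤ (≤-reflexive eq) (scale-≤ a le)) ((7 * x + 4) * a) (solve (n ∷ x ∷ a ∷ b ∷ []))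
  sharp : (n + x + 4) * ballot n (2 + x) + x * ballot n x ≤ (n + x + 4) * ballot n x
  sharp = *-cancelˡ-≤ (suc x) (lemma _ _ (ballot-same-time n x))
  combine : ∀ a b → (n + x + 4) * b + x * a ≤ (n + x + 4) * a →
    (4 + 2 * n) * b + x * a ≤ (4 + 2 * n) * a
  combine a b le with m≤n⇒∃[o]m+o≡n x≤n
  ... | d , refl = ≤-by (+-mono-≤ le (scale-≤ d b≤a)) 0 (solve (x ∷ d ∷ a ∷ b ∷ []))
    where
    b≤a : b ≤ a
    b≤a = *-cancelˡ-≤ (suc (suc (suc (suc (x + d + x)))))
            (≤-by le (x * a) (solve (x ∷ d ∷ a ∷ b ∷ [])))

through-decrease : ∀ n x → 2 * n ≤ x * x →
  (4 + 2 * n) * through n n (2 + x) + x * through n n x ≤ (4 + 2 * n) * through n n x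
through-decrease n x le = lemma (4 + 2 * n) (ballot n x) (ballot n (2 + x)) (ballot-decrease n x le)
  where
  lemma : ∀ D .{{_ : NonZero D}} a b → D * b + x * a ≤ D * a → D * (b * b) + x * (a * a) ≤ D * (a * a)
  lemma D a b le = ≤-by (+-mono-≤ (scale-≤ a le) (scale-≤ (D * b) b≤a)) 0 (solve (D ∷ x ∷ a ∷ b ∷ []))
    where
    b≤a : b ≤ a
    b≤a = *-cancelˡ-≤ D (≤-trans (m≤m+n _ _) le)

-- For x ≥ k, `through-decrease` bounds k f(x) by (4 + 2n)(f(x) - f(x + 2)), which telescopes along
-- both parity classes. The remaining two terms stay on the left to serve as induction hypothesis.
tail-bound : ∀ n k → 2 * n ≤ k * k → ∀ j →
  k * sum< j (λ x → through n n (x + k)) + (4 + 2 * n) * (through n n (j + k) + through n n (suc j + k)) ≤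
  (4 + 2 * n) * (through n n k + through n n (suc k))
tail-bound n k le zero    rewrite *-zeroʳ k = ≤-refl
tail-bound n k le (suc j) =
  lemma (4 + 2 * n) (sum< j (λ x → through n n (x + k))) (through n n (j + k)) (through n n (suc j + k))
    (through n n (2 + (j + k))) (through n n k + through n n (suc k)) (tail-bound n k le j)
    (through-decrease n (j + k) (≤-trans le (*-mono-≤ k≤j+k k≤j+k)))
  where
  k≤j+k : k ≤ j + k
  k≤j+k = m≤n+m k j
  lemma : ∀ D S f g h R → k * S + D * (f + g) ≤ D * R → D * h + (j + k) * f ≤ D * f →
    k * (S + f) + D * (g + h) ≤ D * R
  lemma D S f g h R ih dec = ≤-by (+-mono-≤ ih dec) (j * f) (solve (k ∷ j ∷ D ∷ S ∷ f ∷ g ∷ h ∷ R ∷ []))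

catalan-positive : ∀ n → 1 ≤ catalan n
catalan-positive zero    = ≤-refl
catalan-positive (suc n) rewrite +-suc n n = ≤-trans (catalan-positive n) (ballot-mono-2 (n + n) 0)

-- At least half of the e paths have height k or more. By `tail-bound` they number at most (4 +
-- 2n)(f(k) + f(k + 1))/k, and by `through-bound` this is O(n e/k²). The final constant is 24(4 +
-- 2n).
median-upper : ∀ n k → 2 * n ≤ k * k → 2 * below n n k ≤ catalan n → k * k ≤ 96 + 48 * n
median-upper n k le med =
  *-cancelʳ-≤ _ _ (catalan n) {{>-nonZero (catalan-positive n)}}
    (lemma (below n n k) (sum< (suc n) (λ x → through n n (x + k))) (catalan n)
      (through n n k) (through n n (suc k)) med total
      (≤-trans (m≤m+n _ _) (tail-bound n k le (suc n))) (through-bound n n k) (through-bound n n (suc k)))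
  where
  total : catalan n ≡ below n n k + sum< (suc n) (λ x → through n n (x + k))
  total = trans (sym (below-catalan n n (suc n + k) (m≤m+n (suc n) k))) (sum<-split (suc n) k (through n n))
  lemma : ∀ b S e f g → 2 * b ≤ e → e ≡ b + S → k * S ≤ (4 + 2 * n) * (f + g) →
    f * (k + 1) ≤ 6 * e → g * (suc k + 1) ≤ 6 * e → k * k * e ≤ (96 + 48 * n) * e
  lemma b S e f g 2b≤e e≡b+S tail fb gb =
    ≤-by (+-mono-≤ (+-mono-≤ (scale-≤ ((k + 1) * k) e≤2S) (scale-≤ (2 * (k + 1)) tail))
           (+-mono-≤ (scale-≤ (2 * (4 + 2 * n)) fb) (scale-≤ (2 * (4 + 2 * n)) gb)))
      (k * e + 2 * (4 + 2 * n) * g)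
      (solve (k ∷ n ∷ S ∷ e ∷ f ∷ g ∷ []))
    where
    e≤2S : e ≤ 2 * S
    e≤2S = ≤-by (+-mono-≤ 2b≤e (≤-reflexive (cong (2 *_) e≡b+S))) 0 (solve (b ∷ S ∷ e ∷ []))

-- The median height at time n

crossing : ∀ (f : ℕ → ℕ) e j → f 0 ≤ e → e < f j → ∃[ i ] (i < j × f i ≤ e × e < f (suc i))
crossing f e zero    le lt = contradiction le (<⇒≱ lt)
crossing f e (suc j) le lt with f j ≤? e
... | yes fj≤e = j , ≤-refl , fj≤e , lt
... | no  fj≰e with crossing f e j le (≰⇒> fj≰e)
...   | i , i<j , p = i , m≤n⇒m≤1+n i<j , p

even⊎odd : ∀ d → ∃[ c ] (d ≡ 2 * c ⊎ d ≡ 1 + 2 * c)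
even⊎odd zero    = 0 , inj₁ refl
even⊎odd (suc d) with even⊎odd d
... | c , inj₁ refl = c , inj₂ refl
... | c , inj₂ refl = suc c , inj₁ (lemma c)
  where
  lemma : ∀ c → 2 + 2 * c ≡ 2 * suc c
  lemma = solve-∀

ballot-support : ∀ m k → ballot m k ≢ 0 → ∃[ c ] m ≡ k + 2 * c
ballot-support m k ≢0 with k ≤? m
... | no  k≰m = contradiction (ballot-above m k (≰⇒> k≰m)) ≢0
... | yes k≤m with m≤n⇒∃[o]m+o≡n k≤m
...   | d , refl with even⊎odd d
...     | c , inj₁ refl = c , refl
...     | c , inj₂ refl = contradiction (ballot-odd (k + (1 + 2 * c)) k (k + c) (lemma k c)) ≢0
  where
  lemma : ∀ k c → k + (1 + 2 * c) + k ≡ 1 + 2 * (k + c)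
  lemma = solve-∀

-- The bounds on `k` say that it is of order √n. A path at height `k` at time n has made exactly `c`
-- down-steps.
record Median (n : ℕ) : Set where
  field
    k      : ℕ
    lower  : 2 * below n n k ≤ catalan n
    upper  : catalan n < 2 * below n n (suc k)
    k²≤49n : k * k ≤ 49 * n
    n<9k²  : n < (3 * suc k) * (3 * suc k)
    c      : ℕ
    n≡k+2c : n ≡ k + 2 * c

below-full : ∀ n → catalan n < 2 * below n n (suc n)
below-full n rewrite below-catalan n n (suc n) ≤-refl = double (catalan n) (catalan-positive n)
  where
  double : ∀ e → 1 ≤ e → e < 2 * e
  double e le = ≤-by le 0 (solve (e ∷ []))

median : ∀ n → 96 ≤ n → Median n
median n 96≤n with crossing (λ k → 2 * below n n k) (catalan n) (suc n) z≤n (below-full n)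
... | k , _ , lower , upper = record
  { k = k ; lower = lower ; upper = upper ; k²≤49n = bound
  ; n<9k² = ≰⇒> (λ le → <⇒≱ upper (below-small n (suc k) le))
  ; c = proj₁ supp ; n≡k+2c = proj₂ supp }
  where
  supp : ∃[ c ] n ≡ k + 2 * c
  -- The jump across e/2 means that some path has height k at time n, which forces the parity.
  supp = ballot-support n k λ eq → <⇒≱ upper
    (≤-trans (≤-reflexive (cong (2 *_) (trans (cong (λ b → below n n k + b * b) eq) (+-identityʳ _)))) lower)
  bound : k * k ≤ 49 * n
  -- When `median-upper` applies, the assumption 96 ≤ n absorbs the constant in 96 + 48n.
  bound with 2 * n ≤? k * k
  ... | yes le = ≤-trans (median-upper n k le lower) (+-monoˡ-≤ (48 * n) 96≤n)
  ... | no ¬le = ≤-trans (<⇒≤ (≰⇒> ¬le)) (*-monoˡ-≤ n {2} {49} (s≤s (s≤s z≤n)))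

-- By `ballot-two-steps`, two steps more multiply the first factor by at least 4 - 12/n, and two
-- steps fewer leave of the second at least (1 - 196/n)/4. Here 196 = 4 · 49 comes from (h + 1)² ≤
-- 49n and B ≥ n/2, and 208 = 12 + 196.
through-flat : ∀ n A B h → n ≤ A → n ≤ 2 * B → (h + 1) * (h + 1) ≤ 49 * n →
  n * through A (2 + B) h ≤ n * through (2 + A) B h + 208 * through A (2 + B) h
through-flat n A B h n≤A n≤2B h² =
  combine (ballot A h) (ballot (2 + A) h) (ballot B h) (ballot (2 + B) h)
    (ballot-mono-2 B h) (grow (ballot A h) (ballot (2 + A) h) (ballot-two-steps A h))
    (shrink (ballot B h) (ballot (2 + B) h) (ballot-two-steps B h))
  where
  grow : ∀ u u₂ → 4 * (A + 1) * (A + 2) * u + (h + 1) * (h + 1) * u₂ ≡ (A + 3) * (A + 3) * u₂ →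
    4 * n * u ≤ n * u₂ + 12 * u
  grow u u₂ eq with m≤n⇒∃[o]m+o≡n n≤A
  ... | d , refl = *-cancelˡ-≤ (suc (suc (suc (n + d))))
    (≤-by (scale-≤ n step) (12 * (d + 3) * u) (solve (n ∷ d ∷ u ∷ u₂ ∷ [])))
    where
    step : 4 * (n + d) * u ≤ (n + d + 3) * u₂
    step = *-cancelˡ-≤ (suc (suc (suc (n + d))))
      (≤-by (≤-reflexive eq) (8 * u + (h + 1) * (h + 1) * u₂) (solve (n ∷ d ∷ h ∷ u ∷ u₂ ∷ [])))
  shrink : ∀ v v₂ → 4 * (B + 1) * (B + 2) * v + (h + 1) * (h + 1) * v₂ ≡ (B + 3) * (B + 3) * v₂ →
    n * v₂ ≤ 4 * n * v + 196 * v₂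
  shrink v v₂ eq = *-cancelˡ-≤ (suc (B * B + 3 * B + 1))
    (≤-by (+-mono-≤ (≤-reflexive (sym (cong (n *_) eq))) (+-mono-≤ (scale-≤ (v₂ * n) h²) (scale-≤ (49 * v₂) (*-mono-≤ n≤2B n≤2B))))
      (196 * (3 * B + 2) * v₂ + n * (3 * B + 7) * v₂)
      (solve (n ∷ B ∷ h ∷ v ∷ v₂ ∷ [])))
  combine : ∀ u u₂ v v₂ → v ≤ v₂ → 4 * n * u ≤ n * u₂ + 12 * u → n * v₂ ≤ 4 * n * v + 196 * v₂ →
    n * (u * v₂) ≤ n * (u₂ * v) + 208 * (u * v₂)
  combine u u₂ v v₂ v≤v₂ g s =
    ≤-by (+-mono-≤ (+-mono-≤ (scale-≤ v g) (scale-≤ u s)) (scale-≤ (12 * u) v≤v₂)) 0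
      (solve (n ∷ u ∷ u₂ ∷ v ∷ v₂ ∷ []))

-- Bernoulli's inequality (1 - c/n)^i ≥ 1 - ci/n, where each step keeps at least the fraction 1 -
-- c/n.
bernoulli : ∀ n c (f : ℕ → ℕ) j → 1 ≤ c → c ≤ n → (∀ i → i < j → n * f i ≤ n * f (suc i) + c * f i) →
  ∀ i → i ≤ j → n * f 0 ≤ n * f i + c * i * f 0
bernoulli n c f j 1≤c c≤n step zero    _ = m≤m+n _ _
bernoulli n c f j 1≤c c≤n step (suc i) i<j with m≤n⇒∃[o]m+o≡n c≤n
... | d , refl = *-cancelˡ-≤ (c + d) {{>-nonZero (≤-trans 1≤c c≤n)}}
  (lemma (f 0) (f i) (f (suc i)) (step i i<j) (bernoulli n c f j 1≤c c≤n step i (<⇒≤ i<j)))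
  where
  lemma : ∀ x y z → (c + d) * y ≤ (c + d) * z + c * y → (c + d) * x ≤ (c + d) * y + c * i * x →
    (c + d) * ((c + d) * x) ≤ (c + d) * ((c + d) * z + c * suc i * x)
  lemma x y z s ih = ≤-by (+-mono-≤ (scale-≤ (c + d) s) (scale-≤ d ih)) (c * c * i * x)
    (solve (c ∷ d ∷ i ∷ x ∷ y ∷ z ∷ []))

-- The height-below-(h + 1) counts at times m and m + 2 differ by the flow through the
-- vertex at height h and time m + 1; parity kills the other boundary terms.
below-drop : ∀ m B g c → m + suc g ≡ 1 + 2 * c →
  below (2 + m) B (2 + g) + ballot m g * ballot (suc B) (suc g) ≡
  below m (2 + B) (2 + g) + ballot B g * ballot (suc m) (suc g)
below-drop m B g c odd = begin
  below (2 + m) B (2 + g) + a * b′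
    ≡⟨ cong (_+ a * b′) (trans (sum<-cong (2 + g) (λ x _ → *-comm (ballot (2 + m) x) (ballot B x))) (flow B (ballot (suc m)) g)) ⟩
  sum< (1 + g) (through (suc B) (suc m)) + ballot B (suc g) * ballot (suc m) (2 + g) + b * a′ + a * b′
    ≡⟨ cong₂ (λ S z → S + ballot B (suc g) * z + b * a′ + a * b′)
         (sum<-cong (1 + g) (λ x _ → *-comm (ballot (suc B) x) (ballot (suc m) x)))
         (ballot-odd (suc m) (2 + g) (suc c) odd′) ⟩
  S + ballot B (suc g) * 0 + b * a′ + a * b′
    ≡⟨ lemma S (ballot B (suc g)) (ballot (suc B) (2 + g)) (b * a′) (a * b′) ⟩
  S + 0 * ballot (suc B) (2 + g) + a * b′ + b * a′
    ≡⟨ cong (λ z → S + z * ballot (suc B) (2 + g) + a * b′ + b * a′) (ballot-odd m (suc g) c odd) ⟨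
  S + ballot m (suc g) * ballot (suc B) (2 + g) + a * b′ + b * a′
    ≡⟨ cong (_+ b * a′) (flow m (ballot (suc B)) g) ⟨
  below m (2 + B) (2 + g) + b * a′ ∎
  where
  open ≡-Reasoning
  a = ballot m g
  a′ = ballot (suc m) (suc g)
  b = ballot B g
  b′ = ballot (suc B) (suc g)
  S = sum< (1 + g) (through (suc m) (suc B))
  lemma : ∀ S x y u v → S + x * 0 + u + v ≡ S + 0 * y + v + u
  lemma = solve-∀
  odd′ : suc m + (2 + g) ≡ 1 + 2 * suc c
  odd′ = trans (shift m g) (trans (cong (2 +_) odd) (shift′ c))
    where
    shift : ∀ m g → suc m + (2 + g) ≡ 2 + (m + suc g)
    shift = solve-∀
    shift′ : ∀ c → 2 + (1 + 2 * c) ≡ 1 + 2 * suc c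
    shift′ = solve-∀

-- By `ballot-up` both corner terms of `below-drop` are multiples of the same vertex count, with
-- factors proportional to 1 + (g + 3)/(s + 1) at s = B and s = m. Their difference is therefore
-- proportional to m - B = 2t.
below-drop-exact : ∀ B t g c → B + 2 * t + suc g ≡ 1 + 2 * c → let m = B + 2 * t in
  (g + 2) * ((m + 1) * (B + 1)) * below (2 + m) B (2 + g) ≡
  (g + 2) * ((m + 1) * (B + 1)) * below m (2 + B) (2 + g) + (g + 1) * (g + 3) * (t * through (suc m) (suc B) (suc g))
below-drop-exact B t g c odd =
  lemma _ _ (ballot m g) (ballot (suc m) (suc g)) (ballot B g) (ballot (suc B) (suc g))
    (below-drop m B g c odd) (ballot-up m g) (ballot-up B g)
  where
  m = B + 2 * t
  lemma : ∀ Y X a a′ b b′ → Y + a * b′ ≡ X + b * a′ →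
    2 * (g + 2) * (B + 2 * t + 1) * a ≡ (g + 1) * (B + 2 * t + g + 4) * a′ →
    2 * (g + 2) * (B + 1) * b ≡ (g + 1) * (B + g + 4) * b′ →
    (g + 2) * ((B + 2 * t + 1) * (B + 1)) * Y ≡
    (g + 2) * ((B + 2 * t + 1) * (B + 1)) * X + (g + 1) * (g + 3) * (t * (a′ * b′))
  lemma Y X a a′ b b′ drop ua ub = *-cancelˡ-≡ _ _ 2
    (≡-by (cong₂ _+_ (cong (2 * (g + 2) * ((B + 2 * t + 1) * (B + 1)) *_) (sym drop))
            (cong₂ _+_ (cong ((B + 1) * b′ *_) ua) (cong ((B + 2 * t + 1) * a′ *_) (sym ub))))
      (solve (Y ∷ X ∷ a ∷ a′ ∷ b ∷ b′ ∷ g ∷ B ∷ t ∷ [])))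

-- As (g + 1)(g + 3) ≤ (g + 2)², the drop is at most (g + 2) t f over the area, and `through-bound`
-- cancels g + 2: the bound no longer depends on the height.
below-drop-upper : ∀ B t g c → B + 2 * t + suc g ≡ 1 + 2 * c → let m = B + 2 * t in
  (m + 1) * (B + 1) * below (2 + m) B (2 + g) ≤
  (m + 1) * (B + 1) * below m (2 + B) (2 + g) + 6 * t * ballot (suc m + suc B) 0
below-drop-upper B t g c odd = *-cancelˡ-≤ (suc (suc g))
  (lemma ((m + 1) * (B + 1)) (below (2 + m) B (2 + g)) (below m (2 + B) (2 + g)) (through (suc m) (suc B) (suc g))
    (ballot (suc m + suc B) 0) (below-drop-exact B t g c odd) (through-bound (suc m) (suc B) (suc g)))
  where
  m = B + 2 * t
  lemma : ∀ P Y X f e → (g + 2) * P * Y ≡ (g + 2) * P * X + (g + 1) * (g + 3) * (t * f) →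
    f * (suc g + 1) ≤ 6 * e → suc (suc g) * (P * Y) ≤ suc (suc g) * (P * X + 6 * t * e)
  lemma P Y X f e eq fb = ≤-by (+-mono-≤ (≤-reflexive eq) (scale-≤ ((g + 2) * t) fb)) (t * f)
    (solve (g ∷ t ∷ P ∷ Y ∷ X ∷ f ∷ e ∷ []))

below-drop-lower : ∀ B t g c → B + 2 * t + suc g ≡ 1 + 2 * c → let m = B + 2 * t in
  (m + 1) * (B + 1) * below m (2 + B) (2 + g) + (g + 1) * (t * through (suc m) (suc B) (suc g)) ≤
  (m + 1) * (B + 1) * below (2 + m) B (2 + g)
below-drop-lower B t g c odd = *-cancelˡ-≤ (suc (suc g))
  (lemma ((m + 1) * (B + 1)) (below (2 + m) B (2 + g)) (below m (2 + B) (2 + g)) (through (suc m) (suc B) (suc g))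
    (below-drop-exact B t g c odd))
  where
  m = B + 2 * t
  lemma : ∀ P Y X f → (g + 2) * P * Y ≡ (g + 2) * P * X + (g + 1) * (g + 3) * (t * f) →
    suc (suc g) * (P * X + (g + 1) * (t * f)) ≤ suc (suc g) * (P * Y)
  lemma P Y X f eq = ≤-by (≤-reflexive (sym eq)) ((g + 1) * (t * f)) (solve (g ∷ t ∷ P ∷ Y ∷ X ∷ f ∷ []))

-- Time n + 2i is paired with the remaining time n - 2i; the counts below height 2 + g at these
-- times change by a flow through the vertex at height 1 + g, whose own count is vertex.
slice : ℕ → ℕ → ℕ → ℕ
slice n g i = below (n + 2 * i) (n ∸ 2 * i) (2 + g)

vertex : ℕ → ℕ → ℕ → ℕ
vertex n g i = through (suc (n + 2 * i)) (n ∸ (1 + 2 * i)) (suc g)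

remaining : ∀ {n} B a → n ≡ B + a → n ∸ a ≡ B
remaining B a refl = m+n∸n≡m B a

-- The ring solver expands large literals into unary, so they are kept out of its goals.
8j≤416j : ∀ {n} j → 416 * j ≤ n → 8 * j ≤ n
8j≤416j j 416j≤n = ≤-trans (*-monoˡ-≤ j (≤ᵇ⇒≤ 8 416 _)) 416j≤n

-- The relative loss per step is at most 208/n, so n/416 steps lose at most one half.
vertex-flat : ∀ n g j → 1 ≤ j → 416 * j ≤ n → (2 + g) * (2 + g) ≤ 49 * n →
  ∀ i → i ≤ j → vertex n g 0 ≤ 2 * vertex n g i
vertex-flat n g j 1≤j 416j≤n g² i i≤j =
  *-cancelˡ-≤ n {{>-nonZero 0<n}} (lemma 208 (vertex n g 0) (vertex n g i)
    (≤-trans (≤-reflexive (sym (*-assoc 2 208 i))) (≤-trans (*-monoʳ-≤ 416 i≤j) 416j≤n))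
    (bernoulli n 208 (vertex n g) j (s≤s z≤n) 208≤n step i i≤j))
  where
  8j≤n : 8 * j ≤ n
  8j≤n = 8j≤416j j 416j≤n
  208≤n : 208 ≤ n
  208≤n = ≤-trans (*-mono-≤ (≤ᵇ⇒≤ 208 416 _) 1≤j) 416j≤n
  0<n : 0 < n
  0<n = ≤-trans (s≤s z≤n) 208≤n
  lemma : ∀ C v₀ v → 2 * (C * i) ≤ n → n * v₀ ≤ n * v + C * i * v₀ → n * v₀ ≤ n * (2 * v)
  lemma C v₀ v small le = ≤-by (+-mono-≤ (scale-≤ 2 le) (scale-≤ v₀ small)) 0
    (solve (n ∷ i ∷ C ∷ v₀ ∷ v ∷ []))
  step : ∀ i → i < j → n * vertex n g i ≤ n * vertex n g (suc i) + 208 * vertex n g i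
  step i i<j with m≤n⇒∃[o]m+o≡n {3 + 2 * i} (≤-trans (≤-by {b = 8 * j} (+-mono-≤ (scale-≤ 2 i<j) (scale-≤ 6 1≤j)) 5 (solve (i ∷ j ∷ []))) 8j≤n)
  ... | B , eq = subst₂ (λ v w → n * v ≤ n * w + 208 * v) here next
        (through-flat n (suc (n + 2 * i)) B (suc g) (m≤n⇒m≤1+n (m≤m+n n _))
          n≤2B (subst (λ x → x * x ≤ 49 * n) (+-comm 1 (suc g)) g²))
    where
    n≡ : n ≡ B + (3 + 2 * i)
    n≡ = trans (sym eq) (+-comm (3 + 2 * i) B)
    n≤2B : n ≤ 2 * B
    n≤2B = ≤-by (+-mono-≤ (+-mono-≤ (≤-reflexive (cong (2 *_) (sym eq))) 8j≤n) (+-mono-≤ (scale-≤ 4 i<j) (scale-≤ 4 1≤j)))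
      2 (solve (n ∷ B ∷ i ∷ j ∷ []))
    here : through (suc (n + 2 * i)) (2 + B) (suc g) ≡ vertex n g i
    here = cong (λ b → through (suc (n + 2 * i)) b (suc g)) (sym (remaining (2 + B) (1 + 2 * i) (trans n≡ (shift B i))))
      where
      shift : ∀ B i → B + (3 + 2 * i) ≡ 2 + B + (1 + 2 * i)
      shift = solve-∀
    next : through (2 + suc (n + 2 * i)) B (suc g) ≡ vertex n g (suc i)
    next = cong₂ (λ a b → through a b (suc g)) (time n i) (sym (remaining B (1 + 2 * suc i) (trans n≡ (cong (B +_) (shift i)))))
      where
      time : ∀ n i → 3 + (n + 2 * i) ≡ suc (n + 2 * suc i)
      time = solve-∀
      shift : ∀ i → 3 + 2 * i ≡ 1 + 2 * suc i
      shift = solve-∀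

-- `area` is n² - t² for t = 2i + 1, the denominator of the increment. It is comparable to n² within
-- a factor of two.
record Step (n g i : ℕ) : Set where
  field
    area      : ℕ
    area≤n²   : area ≤ n * n
    n²≤2area  : n * n ≤ 2 * area
    increment : area * slice n g i + (g + 1) * ((1 + 2 * i) * vertex n g i) ≤ area * slice n g (suc i)
    decrement : area * slice n g (suc i) ≤ area * slice n g i + 6 * (1 + 2 * i) * catalan n

-- The bounds on the drop are taken at B = n - 2i - 2 and t = 2i + 1. The assumption 4 + 4i ≤ n
-- makes n - t at least n/2.
slice-step : ∀ n g c i → n ≡ 2 + g + 2 * c → 4 + 4 * i ≤ n → Step n g i
slice-step n g c i n≡k+2c room with m≤n⇒∃[o]m+o≡n (≤-trans (≤-slack {2 + 2 * i} {4 + 4 * i} (2 + 2 * i) (solve (i ∷ []))) room)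
... | B , eq = record
  { area     = (B + 2 * (1 + 2 * i) + 1) * (B + 1)
  ; area≤n²  = subst (λ x → (B + 2 * (1 + 2 * i) + 1) * (B + 1) ≤ x * x) eq (≤-slack (4 * i * i + 4 * i + 1) (solve (B ∷ i ∷ [])))
  ; n²≤2area = ≤-trans (*-mono-≤ n≤s n≤2s′) (≤-reflexive (assoc (B + 2 * (1 + 2 * i) + 1) (B + 1)))
  ; increment = subst₂ (λ X Y → area * proj₁ X + (g + 1) * ((1 + 2 * i) * proj₂ X) ≤ area * Y)
      (cong₂ _,_ slice≡ vertex≡) slice′≡ (below-drop-lower B (1 + 2 * i) g (1 + g + c + i) odd)
  ; decrement = subst₂ (λ X Y → area * proj₁ X ≤ area * proj₂ X + 6 * (1 + 2 * i) * Y)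
      (cong₂ _,_ slice′≡ slice≡) (cong (λ x → ballot x 0) total) (below-drop-upper B (1 + 2 * i) g (1 + g + c + i) odd)
  }
  where
  area = (B + 2 * (1 + 2 * i) + 1) * (B + 1)
  n≤s : n ≤ B + 2 * (1 + 2 * i) + 1
  n≤s = subst (_≤ B + 2 * (1 + 2 * i) + 1) eq (≤-slack (2 * i + 1) (solve (B ∷ i ∷ [])))
  n≤2s′ : n ≤ 2 * (B + 1)
  n≤2s′ = ≤-by (+-mono-≤ (≤-reflexive (cong (2 *_) (sym eq))) room) 2 (solve (n ∷ B ∷ i ∷ []))
  assoc : ∀ a b → a * (2 * b) ≡ 2 * (a * b)
  assoc = solve-∀
  odd : B + 2 * (1 + 2 * i) + suc g ≡ 1 + 2 * (1 + g + c + i)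
  odd = ≡-by (sym (trans eq n≡k+2c)) (solve (B ∷ i ∷ g ∷ c ∷ []))
  n≡ : n ≡ B + (2 + 2 * i)
  n≡ = trans (sym eq) (+-comm (2 + 2 * i) B)
  time : B + 2 * (1 + 2 * i) ≡ n + 2 * i
  time = ≡-by n≡ (solve (n ∷ B ∷ i ∷ []))
  slice≡ : below (B + 2 * (1 + 2 * i)) (2 + B) (2 + g) ≡ slice n g i
  slice≡ = cong₂ (λ a b → below a b (2 + g)) time
    (sym (remaining (2 + B) (2 * i) (trans n≡ (shift B i))))
    where
    shift : ∀ B i → B + (2 + 2 * i) ≡ 2 + B + 2 * i
    shift = solve-∀
  vertex≡ : through (suc (B + 2 * (1 + 2 * i))) (suc B) (suc g) ≡ vertex n g i
  vertex≡ = cong₂ (λ a b → through (suc a) b (suc g)) time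
    (sym (remaining (suc B) (1 + 2 * i) (trans n≡ (shift B i))))
    where
    shift : ∀ B i → B + (2 + 2 * i) ≡ 1 + B + (1 + 2 * i)
    shift = solve-∀
  slice′≡ : below (2 + (B + 2 * (1 + 2 * i))) B (2 + g) ≡ slice n g (suc i)
  slice′≡ = cong₂ (λ a b → below a b (2 + g)) (trans (cong (2 +_) time) (time′ n i))
    (sym (remaining B (2 * suc i) (trans n≡ (cong (B +_) (shift i)))))
    where
    time′ : ∀ n i → 2 + (n + 2 * i) ≡ n + 2 * suc i
    time′ = solve-∀
    shift : ∀ i → 2 + 2 * i ≡ 2 * suc i
    shift = solve-∀
  total : suc (B + 2 * (1 + 2 * i)) + suc B ≡ n + n
  total = ≡-by (cong (2 *_) n≡) (solve (n ∷ B ∷ i ∷ []))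

-- For one factor, append a down-step from height 2 + g to 1 + g. For the other, `ballot-up` shows
-- that at least a quarter of the paths to 2 + g come from 1 + g.
through-vertex : ∀ n g → 1 ≤ n → through n n (2 + g) ≤ 4 * vertex n g 0
through-vertex (suc n) g _ rewrite +-identityʳ n =
  lemma (ballot (suc n) (2 + g)) (ballot (2 + n) (suc g)) (ballot n (suc g)) (m≤m+n _ _)
    (*-cancelˡ-≤ (suc (suc (g * n + 2 * n + g))) (quarter (ballot n (suc g)) (ballot (suc n) (2 + g)) (ballot-up n (suc g))))
  where
  quarter : ∀ a b → 2 * (suc g + 2) * (n + 1) * a ≡ (suc g + 1) * (n + suc g + 4) * b →
    suc (suc (g * n + 2 * n + g)) * b ≤ suc (suc (g * n + 2 * n + g)) * (4 * a)
  quarter a b eq = ≤-by (≤-reflexive (sym eq)) ((g + 2) * (g + 4) * b + 2 * (g + 1) * (n + 1) * a) (solve (g ∷ n ∷ a ∷ b ∷ []))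
  lemma : ∀ x y z → x ≤ y → x ≤ 4 * z → x * x ≤ 4 * (y * z)
  lemma x y z x≤y x≤4z = ≤-trans (*-mono-≤ x≤y x≤4z) (≤-reflexive (solve (y ∷ z ∷ [])))

module _ (n g c j : ℕ) (1≤j : 1 ≤ j) (416j≤n : 416 * j ≤ n) (n≡k+2c : n ≡ 2 + g + 2 * c) where

  private
    1≤n : 1 ≤ n
    1≤n = ≤-trans (*-mono-≤ {1} {416} (s≤s z≤n) 1≤j) 416j≤n

    step : ∀ i → i < j → Step n g i
    step i i<j = slice-step n g c i n≡k+2c
      (≤-trans (≤-by {b = 8 * j} (scale-≤ 4 i<j) (4 * j) (solve (i ∷ j ∷ []))) (8j≤416j j 416j≤n))

  -- Each increment is at least (g + 1)(1 + 2i)v₀/(2n²), because `area` is at most n² and the vertex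
  -- count at least v₀/2. The odd numbers 1 + 2i add up to a square.
  slice-growth : (2 + g) * (2 + g) ≤ 49 * n → ∀ i → i ≤ j →
    2 * (n * n) * slice n g 0 + (g + 1) * (i * i * vertex n g 0) ≤ 2 * (n * n) * slice n g i
  slice-growth g² zero    _   = ≤-reflexive (lemma (2 * (n * n) * slice n g 0) (g + 1))
    where
    lemma : ∀ a b → a + b * 0 ≡ a
    lemma = solve-∀
  slice-growth g² (suc i) i<j =
    lemma area area≤n² (slice n g 0) (slice n g i) (slice n g (suc i)) (vertex n g 0) (vertex n g i)
      (slice-growth g² i (<⇒≤ i<j)) increment (vertex-flat n g j 1≤j 416j≤n g² i (<⇒≤ i<j)) X≤Y
    where
    open Step (step i i<j)
    0<area : 0 < area
    0<area = *-cancelˡ-< 2 0 area (≤-trans (*-mono-≤ 1≤n 1≤n) n²≤2area)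
    X≤Y : slice n g i ≤ slice n g (suc i)
    X≤Y = *-cancelˡ-≤ area {{>-nonZero 0<area}} (≤-trans (m≤m+n _ _) increment)
    lemma : ∀ P → P ≤ n * n → ∀ X₀ X Y v₀ v →
      2 * (n * n) * X₀ + (g + 1) * (i * i * v₀) ≤ 2 * (n * n) * X →
      P * X + (g + 1) * ((1 + 2 * i) * v) ≤ P * Y → v₀ ≤ 2 * v → X ≤ Y →
      2 * (n * n) * X₀ + (g + 1) * (suc i * suc i * v₀) ≤ 2 * (n * n) * Y
    lemma P P≤n² X₀ X Y v₀ v ih inc flat X≤Y with m≤n⇒∃[o]m+o≡n P≤n²
    ... | d , eq rewrite sym eq =
      ≤-by (+-mono-≤ (+-mono-≤ ih (scale-≤ 2 inc)) (+-mono-≤ (scale-≤ ((g + 1) * (1 + 2 * i)) flat) (scale-≤ (2 * d) X≤Y))) 0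
        (solve (P ∷ d ∷ g ∷ i ∷ X₀ ∷ X ∷ Y ∷ v₀ ∷ v ∷ []))

  -- Over the window the slice gains at least the paths at height 2 + g, so it passes e/2 at some i
  -- < j. There the defect is at most twice one increment. The constant is 48 = 2 · 2 · 6 · 2, from
  -- n² ≤ 2 `area`, this doubling, `decrement`, and 1 + 2i ≤ 2j.
  balanced : (2 + g) * (2 + g) ≤ 49 * n → 8 * (n * n) ≤ (g + 1) * (j * j) →
    2 * below n n (2 + g) ≤ catalan n → catalan n < 2 * below n n (3 + g) →
    ∃[ i ] (i < j × 2 * slice n g i ≤ catalan n × n * n * (catalan n ∸ 2 * slice n g i) ≤ 48 * j * catalan n)
  balanced g² j-large lower upper
    with crossing (λ i → 2 * slice n g i) (catalan n) j
           (subst (λ x → 2 * below x n (2 + g) ≤ catalan n) (sym (+-identityʳ n)) lower)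
           (≤-trans upper (scale-≤ 2 grown))
    where
    grown : below n n (3 + g) ≤ slice n g j
    grown = *-cancelˡ-≤ (2 * (n * n)) {{m*n≢0 2 (n * n) {{_}} {{m*n≢0 n n {{>-nonZero 1≤n}} {{>-nonZero 1≤n}}}}}}
      (lemma (below n n (2 + g)) (slice n g 0) (through n n (2 + g)) (vertex n g 0) (slice n g j)
        (cong (λ x → below x n (2 + g)) (sym (+-identityʳ n))) (slice-growth g² j ≤-refl) (through-vertex n g 1≤n))
      where
      lemma : ∀ x X₀ f v₀ Xⱼ → x ≡ X₀ →
        2 * (n * n) * X₀ + (g + 1) * (j * j * v₀) ≤ 2 * (n * n) * Xⱼ →
        f ≤ 4 * v₀ → 2 * (n * n) * (x + f) ≤ 2 * (n * n) * Xⱼ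
      lemma x _ f v₀ Xⱼ refl growth f≤4v₀ =
        ≤-by (+-mono-≤ growth (+-mono-≤ (scale-≤ (2 * (n * n)) f≤4v₀) (scale-≤ v₀ j-large))) 0
          (solve (n ∷ g ∷ j ∷ x ∷ f ∷ v₀ ∷ Xⱼ ∷ []))
  ... | i , i<j , 2X≤e , e<2Y with m≤n⇒∃[o]m+o≡n 2X≤e
  ...   | D , eq = i , i<j , 2X≤e ,
    subst (λ x → n * n * x ≤ 48 * j * catalan n) (sym (remaining D (2 * slice n g i) (trans (sym eq) (+-comm (2 * slice n g i) D))))
      (lemma area (slice n g i) (slice n g (suc i)) (catalan n) n²≤2area eq (<⇒≤ e<2Y) decrement)
    where
    open Step (step i i<j)
    lemma : ∀ P X Y e → n * n ≤ 2 * P → 2 * X + D ≡ e → e ≤ 2 * Y →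
      P * Y ≤ P * X + 6 * (1 + 2 * i) * e → n * n * D ≤ 48 * j * e
    lemma P X Y e n² refl e≤2Y dec =
      ≤-by (+-mono-≤ (+-mono-≤ (scale-≤ D n²) (scale-≤ (2 * P) e≤2Y)) (+-mono-≤ (scale-≤ 4 dec) (scale-≤ (48 * (2 * X + D)) i<j)))
        (24 * (2 * X + D))
        (solve (n ∷ P ∷ X ∷ Y ∷ D ∷ i ∷ j ∷ []))

-- Choosing a window of order n^(3/4)

square-cancel-≤ : ∀ {a b} → a * a ≤ b * b → a ≤ b
square-cancel-≤ {a} {b} le with a ≤? b
... | yes a≤b = a≤b
... | no  a≰b = contradiction le (<⇒≱ (*-mono-< (≰⇒> a≰b) (≰⇒> a≰b)))

fourth : ℕ → ℕ
fourth r = r * r * (r * r)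

fourth-mono-≤ : ∀ {r s} → r ≤ s → fourth r ≤ fourth s
fourth-mono-≤ le = *-mono-≤ (*-mono-≤ le le) (*-mono-≤ le le)

-- Take the integer part r of the fourth root. Then n < (r + 1)⁴ ≤ (2r)⁴ since r ≥ R ≥ 1.
fourth-root : ∀ R n → 1 ≤ R → fourth R ≤ n → ∃[ r ] (R ≤ r × fourth r ≤ n × n ≤ 16 * fourth r)
fourth-root R n 1≤R le with crossing fourth n (suc n) z≤n (≤-trans (≤-reflexive (sym (*-identityʳ (suc n)))) (*-mono-≤ (m≤m*n (suc n) (suc n)) (s≤s z≤n)))
... | r , _ , lower , upper = r , R≤r , lower , ≤-trans (<⇒≤ upper) (≤-trans (fourth-mono-≤ (+-monoˡ-≤ r (≤-trans 1≤R R≤r))) (≤-reflexive (double r)))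
  where
  R≤r : R ≤ r
  R≤r with R ≤? r
  ... | yes R≤r = R≤r
  ... | no  R≰r = contradiction (≤-trans (fourth-mono-≤ (≰⇒> R≰r)) le) (<⇒≱ upper)
  double : ∀ r → (r + r) * (r + r) * ((r + r) * (r + r)) ≡ 16 * (r * r * (r * r))
  double = solve-∀

-- `bound` is the estimate O(e n^(-5/4)) raised to the fourth power, which avoids roots. `i≤c` says
-- exactly that column c + i + g + 1 exists.
record Balanced (K n : ℕ) : Set where
  field
    g c i  : ℕ
    n≡k+2c : n ≡ 2 + g + 2 * c
    i≤c    : i ≤ c
    lower  : 2 * slice n g i ≤ catalan n
    bound  : (catalan n ∸ 2 * slice n g i) ^ 4 * n ^ 5 ≤ K * catalan n ^ 4

*-^ : ∀ a b k → (a * b) ^ k ≡ a ^ k * b ^ k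
*-^ a b zero    = refl
*-^ a b (suc k) = trans (cong (a * b *_) (*-^ a b k)) (interchange a b (a ^ k) (b ^ k))
  where
  interchange : ∀ a b c d → a * b * (c * d) ≡ a * c * (b * d)
  interchange = solve-∀

fourth-^ : ∀ r → fourth r ^ 5 ≡ (r * r * r * r * r) ^ 4
fourth-^ r = begin
  fourth r ^ 5            ≡⟨ cong (_^ 5) (lemma r) ⟩
  (r ^ 4) ^ 5             ≡⟨ ^-*-assoc r 4 5 ⟩
  r ^ 20                  ≡⟨ ^-*-assoc r 5 4 ⟨
  (r ^ 5) ^ 4             ≡⟨ cong (_^ 4) (lemma′ r) ⟩
  (r * r * r * r * r) ^ 4 ∎
  where
  open ≡-Reasoning
  lemma : ∀ r → r * r * (r * r) ≡ r * (r * (r * (r * 1)))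
  lemma = solve-∀
  lemma′ : ∀ r → r * (r * (r * (r * (r * 1)))) ≡ r * r * r * r * r
  lemma′ = solve-∀

-- The hypothesis gives r⁸ D ≤ A r³ e, that is D r⁵ ≤ A e. In its fourth power, r²⁰ is at least
-- (n/b)⁵.
numeric : ∀ A b n r D e .{{_ : NonZero r}} → fourth r ≤ n → n ≤ b * fourth r →
  n * n * D ≤ A * (r * (r * r)) * e → D ^ 4 * n ^ 5 ≤ b ^ 5 * A ^ 4 * e ^ 4
numeric A b n r D e r⁴≤n n≤br⁴ le = begin
  D ^ 4 * n ^ 5                               ≤⟨ *-monoʳ-≤ (D ^ 4) (^-monoˡ-≤ 5 n≤br⁴) ⟩
  D ^ 4 * (b * fourth r) ^ 5                  ≡⟨ cong (D ^ 4 *_) (*-^ b (fourth r) 5) ⟩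
  D ^ 4 * (b ^ 5 * fourth r ^ 5)              ≡⟨ cong (λ x → D ^ 4 * (b ^ 5 * x)) (fourth-^ r) ⟩
  D ^ 4 * (b ^ 5 * (r * r * r * r * r) ^ 4)   ≡⟨ swap (D ^ 4) (b ^ 5) ((r * r * r * r * r) ^ 4) ⟩
  b ^ 5 * (D ^ 4 * (r * r * r * r * r) ^ 4)   ≡⟨ cong (b ^ 5 *_) (*-^ D (r * r * r * r * r) 4) ⟨
  b ^ 5 * (D * (r * r * r * r * r)) ^ 4       ≤⟨ *-monoʳ-≤ (b ^ 5) (^-monoˡ-≤ 4 fifth) ⟩
  b ^ 5 * (A * e) ^ 4                         ≡⟨ cong (b ^ 5 *_) (*-^ A e 4) ⟩
  b ^ 5 * (A ^ 4 * e ^ 4)                     ≡⟨ *-assoc (b ^ 5) (A ^ 4) (e ^ 4) ⟨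
  b ^ 5 * A ^ 4 * e ^ 4                       ∎
  where
  open ≤-Reasoning
  swap : ∀ x y z → x * (y * z) ≡ y * (x * z)
  swap = solve-∀
  fifth : D * (r * r * r * r * r) ≤ A * e
  fifth = *-cancelˡ-≤ (r * r * r) {{m*n≢0 (r * r) r {{m*n≢0 r r}}}} (begin
    r * r * r * (D * (r * r * r * r * r)) ≡⟨ left r D ⟩
    fourth r * fourth r * D               ≤⟨ *-monoˡ-≤ D (*-mono-≤ r⁴≤n r⁴≤n) ⟩
    n * n * D                             ≤⟨ le ⟩
    A * (r * (r * r)) * e                 ≡⟨ right A r e ⟩
    r * r * r * (A * e)                   ∎)
    where
    left : ∀ r D → r * r * r * (D * (r * r * r * r * r)) ≡ r * r * (r * r) * (r * r * (r * r)) * D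
    left = solve-∀
    right : ∀ a r e → a * (r * (r * r)) * e ≡ r * r * r * (a * e)
    right = solve-∀

window-small : ∀ a b r {n} → a * b ≤ r → fourth r ≤ n → a * (b * (r * (r * r))) ≤ n
window-small a b r {n} ab≤r r⁴≤n = begin
  a * (b * (r * (r * r))) ≡⟨ *-assoc a b (r * (r * r)) ⟨
  a * b * (r * (r * r))   ≤⟨ *-monoˡ-≤ (r * (r * r)) ab≤r ⟩
  r * (r * (r * r))       ≡⟨ *-assoc r r (r * r) ⟨
  fourth r                ≤⟨ r⁴≤n ⟩
  n                       ∎
  where open ≤-Reasoning

-- This supplies 8n² ≤ h j² for n ≤ b r⁴, j = c r³ and h ≥ r²/d, with a = 8.
window-large : ∀ a b c d r h → r * r ≤ d * h → a * (b * b) * d ≤ c * c →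
  a * (b * fourth r * (b * fourth r)) ≤ h * (c * (r * (r * r)) * (c * (r * (r * r))))
window-large a b c d r h r²≤dh small = begin
  a * (b * fourth r * (b * fourth r))                     ≡⟨ collect a b r ⟩
  a * (b * b) * (r * r * r * r * r * r) * (r * r)         ≤⟨ *-monoʳ-≤ (a * (b * b) * (r * r * r * r * r * r)) r²≤dh ⟩
  a * (b * b) * (r * r * r * r * r * r) * (d * h)         ≡⟨ exchange (a * (b * b)) d (r * r * r * r * r * r) h ⟩
  a * (b * b) * d * (h * (r * r * r * r * r * r))         ≤⟨ *-monoˡ-≤ (h * (r * r * r * r * r * r)) small ⟩
  c * c * (h * (r * r * r * r * r * r))                   ≡⟨ distribute c r h ⟩
  h * (c * (r * (r * r)) * (c * (r * (r * r))))           ∎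
  where
  open ≤-Reasoning
  collect : ∀ a b r → a * (b * (r * r * (r * r)) * (b * (r * r * (r * r)))) ≡ a * (b * b) * (r * r * r * r * r * r) * (r * r)
  collect = solve-∀
  exchange : ∀ a d p h → a * p * (d * h) ≡ a * d * (h * p)
  exchange = solve-∀
  distribute : ∀ c r h → c * c * (h * (r * r * r * r * r * r)) ≡ h * (c * (r * (r * r)) * (c * (r * (r * r))))
  distribute = solve-∀

twice-≤ : ∀ n k C → 4 * C ≤ n → k * k ≤ C * n → 2 * k ≤ n
twice-≤ n k C 4C≤n le = square-cancel-≤ (≤-by (+-mono-≤ (scale-≤ 4 le) (scale-≤ n 4C≤n)) 0 (solve (k ∷ n ∷ C ∷ [])))

-- The height takes at most half of n, so 4c = 2n - 2(2 + g) ≥ n ≥ 8j.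
step-room : ∀ n g c i j → n ≡ 2 + g + 2 * c → 2 * (2 + g) ≤ n → 8 * j ≤ n → i < j → i ≤ c
step-room n g c i j n≡ 2k≤n 8j≤n i<j = *-cancelˡ-≤ 4
  (≤-by (+-mono-≤ (+-mono-≤ 2k≤n 8j≤n) (+-mono-≤ (scale-≤ 4 i<j) (≤-reflexive (cong (2 *_) n≡))))
    (4 + 4 * j) (solve (n ∷ g ∷ c ∷ i ∷ j ∷ [])))

window-balanced : ∀ K n q j → 1 ≤ j → 416 * j ≤ n → 9 ≤ q → q * q ≤ n →
  (∀ h → q ≤ 8 * h → 8 * (n * n) ≤ h * (j * j)) →
  (∀ D e → n * n * D ≤ 48 * j * e → D ^ 4 * n ^ 5 ≤ K * e ^ 4) →
  Balanced K n
window-balanced K n q j 1≤j 416j≤n 9≤q q²≤n large convert = from-median (median n 96≤n)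
  where
  416≤n : 416 ≤ n
  416≤n = ≤-trans (*-monoʳ-≤ 416 1≤j) 416j≤n
  96≤n : 96 ≤ n
  96≤n = ≤-trans (≤ᵇ⇒≤ 96 416 _) 416≤n
  from-median : Median n → Balanced K n
  from-median M = go k refl
    where
    open Median M
    q<3k+3 : q < 3 * suc k
    q<3k+3 = ≰⇒> λ le → <⇒≱ n<9k² (≤-trans (*-mono-≤ le le) q²≤n)
    from-step : ∀ g → k ≡ 2 + g →
      ∃[ i ] (i < j × 2 * slice n g i ≤ catalan n × n * n * (catalan n ∸ 2 * slice n g i) ≤ 48 * j * catalan n) →
      Balanced K n
    from-step g k≡ (i , i<j , lower′ , bound) = record
      { g = g ; c = c ; i = i ; n≡k+2c = n≡2+g+2c
      ; i≤c = step-room n g c i j n≡2+g+2c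
                (subst (λ x → 2 * x ≤ n) k≡ (twice-≤ n k 49 (≤-trans (≤ᵇ⇒≤ 196 416 _) 416≤n) k²≤49n)) (8j≤416j j 416j≤n) i<j
      ; lower = lower′ ; bound = convert (catalan n ∸ 2 * slice n g i) (catalan n) bound }
      where
      n≡2+g+2c : n ≡ 2 + g + 2 * c
      n≡2+g+2c = subst (λ x → n ≡ x + 2 * c) k≡ n≡k+2c
    go : ∀ k′ → k ≡ k′ → Balanced K n
    -- Heights k = 0 and k = 1 would give q < 3 and q < 6, against 9 ≤ q.
    go zero          eq = contradiction (subst (λ x → q < 3 * suc x) eq q<3k+3) (≤⇒≯ (≤-trans (≤ᵇ⇒≤ 3 9 _) 9≤q))
    go (suc zero)    eq = contradiction (subst (λ x → q < 3 * suc x) eq q<3k+3) (≤⇒≯ (≤-trans (≤ᵇ⇒≤ 6 9 _) 9≤q))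
    go (suc (suc g)) eq = from-step g eq (balanced n g c j 1≤j 416j≤n
      (subst (λ x → n ≡ x + 2 * c) eq n≡k+2c) (subst (λ x → x * x ≤ 49 * n) eq k²≤49n)
      (large (g + 1) (room q g (subst (λ x → q < 3 * suc x) eq q<3k+3)))
      (subst (λ x → 2 * below n n x ≤ catalan n) eq lower) (subst (λ x → catalan n < 2 * below n n (suc x)) eq upper))
      where
      room : ∀ q g → q < 3 * (3 + g) → q ≤ 8 * (g + 1)
      room q g q< = ≤-by q< (5 * g) (solve (q ∷ g ∷ []))

-- The window is j = 128r³ and q = r². The factor 128 satisfies 128² = 8 · 16² · 8, as
-- `window-large` demands, and r ≥ 416 · 128 yields 416j ≤ r⁴ ≤ n.
balanced-exists : ∀ n r → 416 * 128 ≤ r → fourth r ≤ n → n ≤ 16 * fourth r → Balanced (16 ^ 5 * (48 * 128) ^ 4) n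
balanced-exists n r large r⁴≤n n≤16r⁴ = window-balanced (16 ^ 5 * (48 * 128) ^ 4) n (r * r) (128 * (r * (r * r)))
  (*-mono-≤ {1} {128} (s≤s z≤n) (*-mono-≤ 1≤r (*-mono-≤ 1≤r 1≤r)))
  (window-small 416 128 r large r⁴≤n)
  (*-mono-≤ {3} {r} {3} {r} 3≤r 3≤r)
  r⁴≤n
  (λ h q≤8h → ≤-trans (*-monoʳ-≤ 8 (*-mono-≤ n≤16r⁴ n≤16r⁴))
    (window-large 8 16 128 8 r h q≤8h (≤ᵇ⇒≤ (8 * (16 * 16) * 8) (128 * 128) _)))
  (λ D e le → numeric (48 * 128) 16 n r D e {{>-nonZero 1≤r}} r⁴≤n n≤16r⁴
    (subst (λ x → n * n * D ≤ x * e) (sym (*-assoc 48 128 (r * (r * r)))) le))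
  where
  3≤r : 3 ≤ r
  3≤r = ≤-trans (≤ᵇ⇒≤ 3 (416 * 128) _) large
  1≤r : 1 ≤ r
  1≤r = ≤-trans (s≤s z≤n) 3≤r

-- Arithmetic of columns, times and letter counts

counts-exceed : ∀ h a b β → β + h < a → β < b → 1 + (2 * β + h) < a + b
counts-exceed h a b β p q = ≤-by (+-mono-≤ p q) 0 (solve (a ∷ b ∷ β ∷ h ∷ []))

counts-fall-short : ∀ h a b β → a ≤ β + h → b ≤ β → a + b < 1 + (2 * β + h)
counts-fall-short h a b β p q = ≤-by (+-mono-≤ p q) 0 (solve (a ∷ b ∷ β ∷ h ∷ []))

-- Since x = 2a - (2β + h + 1), a ≤ β + h gives x ≤ h - 1, whereas a > β + h gives x ≥ h + 1. Parity
-- excludes x = h.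
difference-small : ∀ h a b x β → a ≤ β + h → a + b ≡ 1 + (2 * β + h) → x + b ≡ a → x < suc h
difference-small h a b x β a≤ total eq =
  ≤-by (+-mono-≤ (scale-≤ 2 a≤) (+-mono-≤ (≤-reflexive (sym total)) (≤-reflexive eq))) 1
    (solve (a ∷ b ∷ x ∷ β ∷ h ∷ []))

difference-small⁻¹ : ∀ h a b x β → x < suc h → a + b ≡ 1 + (2 * β + h) → x + b ≡ a → a ≤ β + h
difference-small⁻¹ h a b x β x< total eq = ≮⇒≥ λ lt → n≮n 0 (absurd lt)
  where
  absurd : β + h < a → 0 < 0
  absurd lt = ≤-by (+-mono-≤ (+-mono-≤ x< (scale-≤ 2 lt)) (+-mono-≤ (≤-reflexive total) (≤-reflexive (sym eq)))) 0
    (solve (a ∷ b ∷ x ∷ β ∷ h ∷ []))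

remainder-dist : ∀ X Y e → X + Y ≡ e → 2 * X ≤ e → ∣ X - Y ∣ ≡ e ∸ 2 * X
remainder-dist X Y _ refl 2X≤e = trans (m≤n⇒∣m-n∣≡n∸m X≤Y) (trans (sym ([m+n]∸[m+o]≡n∸o X Y X)) (cong (X + Y ∸_) (cong (X +_) (sym (+-identityʳ X)))))
  where
  X≤Y : X ≤ Y
  X≤Y = ≤-by 2X≤e 0 (solve (X ∷ Y ∷ []))

column-bound : ∀ n g c i → n ≡ 2 + g + 2 * c → i ≤ c → c + i + suc g < n
column-bound n g c i n≡ i≤c = ≤-by (+-mono-≤ i≤c (≤-reflexive (sym n≡))) 0 (solve (n ∷ c ∷ i ∷ g ∷ []))

shift-bound : ∀ n g c i → n ≡ 2 + g + 2 * c → i ≤ c → 2 * i ≤ n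
shift-bound n g c i n≡ i≤c = ≤-by (+-mono-≤ (scale-≤ 2 i≤c) (≤-reflexive (sym n≡))) (2 + g) (solve (n ∷ c ∷ i ∷ g ∷ []))

slice-time : ∀ n g c i → n ≡ 2 + g + 2 * c → n + 2 * i ≡ 1 + (2 * (c + i) + suc g)
slice-time n g c i n≡ = ≡-by (sym n≡) (solve (n ∷ c ∷ i ∷ g ∷ []))

-- Words and linear extensions

open import Data.Bool using (Bool; true; false; not; if_then_else_)
open import Data.Bool.Properties using (if-eta)
open import Data.Fin using (Fin; zero; suc; toℕ; fromℕ<; combine; remQuot)
open import Data.Fin.Properties using (toℕ<n; toℕ-injective; toℕ-fromℕ<; any?; remQuot-combine; combine-remQuot) renaming (_≟_ to _≟F_)
open import Data.List.Properties using (length-map; length-++; filter-++)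
open import Data.List.Membership.Propositional using (_∈_)
open import Data.List.Membership.Propositional.Properties using (∈-map⁺; ∈-map⁻; ∈-++⁺ˡ; ∈-++⁺ʳ; ∈-++⁻; ∈-filter⁺; ∈-filter⁻; ∈-cartesianProductWith⁺; ∈-allFin)
open import Data.List.Membership.Propositional.Properties.WithK using (unique∧set⇒bag)
open import Data.List.Relation.Binary.BagAndSetEquality using (∼bag⇒↭)
open import Data.List.Relation.Binary.Permutation.Propositional using (_↭_)
open import Data.List.Relation.Binary.Permutation.Propositional.Properties using (↭-length; filter-↭)
open import Data.List.Relation.Unary.Any using (here; there)
open import Data.List.Relation.Unary.All using ([]; _∷_)
import Data.List.Relation.Unary.All as All
open import Data.List.Relation.Unary.AllPairs using ([]; _∷_)
open import Data.List.Relation.Unary.Unique.Propositional using (Unique)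
import Data.List.Relation.Unary.Unique.Propositional.Properties as Unique
open import Data.Vec using (Vec; []; _∷_; lookup; tabulate)
import Data.Vec.Properties as Vec

-- Counting in filtered lists

module _ {A : Set} where

  length-filter-cong : ∀ {P Q : Pred A 0ℓ} (P? : Decidable P) (Q? : Decidable Q) xs →
    (∀ {x} → x ∈ xs → P x ⇔ Q x) → length (filter P? xs) ≡ length (filter Q? xs)
  length-filter-cong P? Q? []       eqv = refl
  length-filter-cong P? Q? (x ∷ xs) eqv with P? x | Q? x
  ... | yes _  | yes _  = cong suc (length-filter-cong P? Q? xs (eqv ∘ there))
  ... | no  _  | no  _  = length-filter-cong P? Q? xs (eqv ∘ there)
  ... | yes px | no ¬qx = contradiction (Equivalence.to (eqv (here refl)) px) ¬qx
  ... | no ¬px | yes qx = contradiction (Equivalence.from (eqv (here refl)) qx) ¬px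

  length-filter-complement : ∀ {P Q : Pred A 0ℓ} (P? : Decidable P) (Q? : Decidable Q) xs →
    (∀ {x} → x ∈ xs → Q x ⇔ (¬ P x)) → length (filter P? xs) + length (filter Q? xs) ≡ length xs
  length-filter-complement P? Q? []       eqv = refl
  length-filter-complement P? Q? (x ∷ xs) eqv with P? x | Q? x
  ... | yes _  | no _   = cong suc (length-filter-complement P? Q? xs (eqv ∘ there))
  ... | no _   | yes _  = trans (+-suc _ _) (cong suc (length-filter-complement P? Q? xs (eqv ∘ there)))
  ... | yes px | yes qx = contradiction px (Equivalence.to (eqv (here refl)) qx)
  ... | no ¬px | no ¬qx = contradiction (Equivalence.from (eqv (here refl)) ¬px) ¬qx

  length-filter-const : ∀ {P : Set} (P? : Dec P) (xs : List A) →
    length (filter (λ _ → P?) xs) ≡ (if does P? then length xs else 0)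
  length-filter-const P? []       = sym (if-eta (does P?))
  length-filter-const P? (x ∷ xs) with does P? | length-filter-const P? xs
  ... | true  | eq = cong suc eq
  ... | false | eq = eq

module _ {A B : Set} where

  length-filter-map : ∀ {Q : Pred B 0ℓ} (Q? : Decidable Q) (f : A → B) xs →
    length (filter Q? (map f xs)) ≡ length (filter (Q? ∘ f) xs)
  length-filter-map Q? f []       = refl
  length-filter-map Q? f (x ∷ xs) with does (Q? (f x))
  ... | true  = cong suc (length-filter-map Q? f xs)
  ... | false = length-filter-map Q? f xs

  map-unique : ∀ (f : A → B) xs → (∀ {x y} → x ∈ xs → y ∈ xs → f x ≡ f y → x ≡ y) → Unique xs → Unique (map f xs)
  map-unique f []       inj []         = []
  map-unique f (x ∷ xs) inj (x∉ ∷ uxs) =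
    All.tabulate (λ y∈ fx≡y → let z , z∈ , y≡fz = ∈-map⁻ f y∈ in
      All.lookup x∉ z∈ (inj (here refl) (there z∈) (trans fx≡y y≡fz)))
    ∷ map-unique f xs (λ x∈ y∈ → inj (there x∈) (there y∈)) uxs

  length-filter-transport : ∀ {P : Pred A 0ℓ} {Q : Pred B 0ℓ} (P? : Decidable P) (Q? : Decidable Q) (f : A → B) xs ys →
    map f xs ↭ ys → (∀ {x} → x ∈ xs → P x ⇔ Q (f x)) → length (filter P? xs) ≡ length (filter Q? ys)
  length-filter-transport P? Q? f xs ys perm eqv =
    trans (length-filter-cong P? (Q? ∘ f) xs eqv)
      (trans (sym (length-filter-map Q? f xs)) (↭-length (filter-↭ Q? perm)))

-- A word is read as a path, true being an up-step.
Word : ℕ → Set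
Word = Vec Bool

hit : Bool → Bool → ℕ
hit true  true  = 1
hit false false = 1
hit true  false = 0
hit false true  = 0

count : ∀ {l} → Bool → Word l → ℕ → ℕ
count b w       zero    = 0
count b []      (suc p) = 0
count b (x ∷ w) (suc p) = hit b x + count b w p

hit-refl : ∀ b → hit b b ≡ 1
hit-refl true  = refl
hit-refl false = refl

count-suc : ∀ {l} b (w : Word l) (p : Fin l) → count b w (suc (toℕ p)) ≡ hit b (lookup w p) + count b w (toℕ p)
count-suc b (x ∷ w) zero    = refl
count-suc b (x ∷ w) (suc p) rewrite count-suc b w p = lemma (hit b x) (hit b (lookup w p)) (count b w (toℕ p))
  where
  lemma : ∀ x y z → x + (y + z) ≡ y + (x + z)
  lemma = solve-∀

count-next : ∀ {l} b (w : Word l) (p : Fin l) → lookup w p ≡ b → count b w (suc (toℕ p)) ≡ suc (count b w (toℕ p))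
count-next b w p refl = trans (count-suc b w p) (cong (_+ count b w (toℕ p)) (hit-refl b))

count-mono-≤ : ∀ {l} b (w : Word l) {p q} → p ≤ q → count b w p ≤ count b w q
count-mono-≤ b w       z≤n      = z≤n
count-mono-≤ b []      (s≤s le) = z≤n
count-mono-≤ b (x ∷ w) (s≤s le) = +-monoʳ-≤ (hit b x) (count-mono-≤ b w le)

count-total : ∀ {l} (w : Word l) p → p ≤ l → count true w p + count false w p ≡ p
count-total w           zero    _        = refl
count-total (true ∷ w)  (suc p) (s≤s le) = cong suc (count-total w p le)
count-total (false ∷ w) (suc p) (s≤s le) = trans (+-suc _ _) (cong suc (count-total w p le))

count-strict : ∀ {l} b (w : Word l) (p q : Fin l) → lookup w p ≡ b → toℕ p < toℕ q → count b w (toℕ p) < count b w (toℕ q)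
count-strict b w p q wp p<q = ≤-trans (≤-reflexive (sym (count-next b w p wp))) (count-mono-≤ b w p<q)

position-unique : ∀ {l} b (w : Word l) (p q : Fin l) → lookup w p ≡ b → lookup w q ≡ b →
  count b w (toℕ p) ≡ count b w (toℕ q) → p ≡ q
position-unique b w p q wp wq eq = toℕ-injective (≤-antisym
  (≮⇒≥ (λ q<p → <-irrefl (sym eq) (count-strict b w q p wq q<p)))
  (≮⇒≥ (λ p<q → <-irrefl eq (count-strict b w p q wp p<q))))

position : ∀ {l} b (w : Word l) j → j < count b w l → ∃[ p ] (lookup w p ≡ b × count b w (toℕ p) ≡ j)
position {suc l} true (true ∷ w) zero    lt = zero , refl , refl
position {suc l} true (true ∷ w) (suc j) lt with position true w j (s<s⁻¹ lt)
... | p , wp , eq = suc p , wp , cong suc eq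
position {suc l} true (false ∷ w) j lt with position true w j lt
... | p , wp , eq = suc p , wp , eq
position {suc l} false (false ∷ w) zero    lt = zero , refl , refl
position {suc l} false (false ∷ w) (suc j) lt with position false w j (s<s⁻¹ lt)
... | p , wp , eq = suc p , wp , cong suc eq
position {suc l} false (true ∷ w) j lt with position false w j lt
... | p , wp , eq = suc p , wp , eq

-- Nonnegative paths from height `h` down to 0, as words

Dyck : ∀ {l} → ℕ → Word l → Set
Dyck {l} h w = (∀ p → p ≤ l → count false w p ≤ h + count true w p) × count false w l ≡ h + count true w l

dyck : ℕ → ∀ l → List (Word l)
dyck zero    zero    = [] ∷ []
dyck (suc h) zero    = []
dyck zero    (suc l) = map (true ∷_) (dyck 1 l)
dyck (suc h) (suc l) = map (true ∷_) (dyck (2 + h) l) ++ map (false ∷_) (dyck h l)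

true∷-Dyck : ∀ {l h} {w : Word l} → Dyck h (true ∷ w) ⇔ Dyck (suc h) w
true∷-Dyck {l} {h} {w} = mk⇔
  (λ (pre , end) → (λ p p≤l → ≤-trans (pre (suc p) (s≤s p≤l)) (≤-reflexive (+-suc h _))) , trans end (+-suc h _))
  (λ (pre , end) → (λ { zero _ → z≤n ; (suc p) (s≤s p≤l) → ≤-trans (pre p p≤l) (≤-reflexive (sym (+-suc h _))) }) , trans end (sym (+-suc h _)))

false∷-Dyck : ∀ {l h} {w : Word l} → Dyck (suc h) (false ∷ w) ⇔ Dyck h w
false∷-Dyck {l} {h} {w} = mk⇔
  (λ (pre , end) → (λ p p≤l → s≤s⁻¹ (pre (suc p) (s≤s p≤l))) , suc-injective end)
  (λ (pre , end) → (λ { zero _ → z≤n ; (suc p) (s≤s p≤l) → s≤s (pre p p≤l) }) , cong suc end)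

∈-dyck⁺ : ∀ {l} h (w : Word l) → Dyck h w → w ∈ dyck h l
∈-dyck⁺ zero    []          _ = here refl
∈-dyck⁺ (suc h) []          (_ , ())
∈-dyck⁺ zero    (true ∷ w)  d = ∈-map⁺ _ (∈-dyck⁺ 1 w (Equivalence.to true∷-Dyck d))
∈-dyck⁺ (suc h) (true ∷ w)  d = ∈-++⁺ˡ (∈-map⁺ _ (∈-dyck⁺ (2 + h) w (Equivalence.to true∷-Dyck d)))
∈-dyck⁺ zero    (false ∷ w) d with () ← proj₁ d 1 (s≤s z≤n)
∈-dyck⁺ (suc h) (false ∷ w) d = ∈-++⁺ʳ _ (∈-map⁺ _ (∈-dyck⁺ h w (Equivalence.to false∷-Dyck d)))

∈-dyck⁻ : ∀ {l} h (w : Word l) → w ∈ dyck h l → Dyck h w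
∈-dyck⁻ {zero}  zero    [] _ = (λ { zero _ → z≤n }) , refl
∈-dyck⁻ {suc l} zero    w  w∈ with ∈-map⁻ _ w∈
... | u , u∈ , refl = Equivalence.from true∷-Dyck (∈-dyck⁻ 1 u u∈)
∈-dyck⁻ {suc l} (suc h) w  w∈ with ∈-++⁻ (map (true ∷_) (dyck (2 + h) l)) w∈
... | inj₁ w∈₁ with u , u∈ , refl ← ∈-map⁻ _ w∈₁ = Equivalence.from true∷-Dyck (∈-dyck⁻ (2 + h) u u∈)
... | inj₂ w∈₂ with u , u∈ , refl ← ∈-map⁻ _ w∈₂ = Equivalence.from false∷-Dyck (∈-dyck⁻ h u u∈)

dyck-unique : ∀ h l → Unique (dyck h l)
dyck-unique zero    zero    = [] ∷ []
dyck-unique (suc h) zero    = []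
dyck-unique zero    (suc l) = Unique.map⁺ Vec.∷-injectiveʳ (dyck-unique 1 l)
dyck-unique (suc h) (suc l) = Unique.++⁺
  (Unique.map⁺ Vec.∷-injectiveʳ (dyck-unique (2 + h) l)) (Unique.map⁺ Vec.∷-injectiveʳ (dyck-unique h l))
  λ (u∈ , v∈) → case-heads (∈-map⁻ _ u∈) (∈-map⁻ _ v∈)
  where
  case-heads : ∀ {w} → (∃[ u ] (u ∈ dyck (2 + h) l × w ≡ true ∷ u)) → ¬ (∃[ v ] (v ∈ dyck h l × w ≡ false ∷ v))
  case-heads (_ , _ , refl) (_ , _ , ())

-- On words of `dyck h l` the truncation in `pred` never acts, as they have no down-step from height
-- 0.
height : ∀ {l} → ℕ → Word l → ℕ → ℕ
height h w           zero    = h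
height h []          (suc p) = h
height h (true ∷ w)  (suc p) = height (suc h) w p
height h (false ∷ w) (suc p) = height (pred h) w p

height-count : ∀ {l} h (w : Word l) → w ∈ dyck h l → ∀ p → height h w p + count false w p ≡ h + count true w p
height-count         h       w  w∈ zero    = refl
height-count {zero}  zero    [] w∈ (suc p) = refl
height-count {suc l} zero    w  w∈ (suc p) with ∈-map⁻ _ w∈
... | u , u∈ , refl = height-count 1 u u∈ p
height-count {suc l} (suc h) w  w∈ (suc p) with ∈-++⁻ (map (true ∷_) (dyck (2 + h) l)) w∈
... | inj₁ w∈₁ with u , u∈ , refl ← ∈-map⁻ _ w∈₁ =
  trans (height-count (2 + h) u u∈ p) (cong suc (sym (+-suc h _)))
... | inj₂ w∈₂ with u , u∈ , refl ← ∈-map⁻ _ w∈₂ =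
  trans (+-suc _ _) (cong suc (height-count h u u∈ p))

dyck-length : ∀ h l → length (dyck h l) ≡ ballot l h
dyck-length zero    zero    = refl
dyck-length (suc h) zero    = refl
dyck-length zero    (suc l) = trans (length-map _ (dyck 1 l)) (dyck-length 1 l)
dyck-length (suc h) (suc l) = trans (length-++ (map (true ∷_) (dyck (2 + h) l)))
  (cong₂ _+_ (trans (length-map _ (dyck (2 + h) l)) (dyck-length (2 + h) l))
             (trans (length-map _ (dyck h l)) (dyck-length h l)))

restrict : ℕ → (ℕ → ℕ) → ℕ → ℕ
restrict K φ x = if does (x <? K) then φ x else 0

-- Removing the first letter is one `transfer`. After m letters the suffixes are counted by
-- `ballot B`, cut off at K.
dyck-filter : ∀ K m B h →
  length (filter (λ w → height h w m <? K) (dyck h (m + B))) ≡ transfers m (restrict K (ballot B)) h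
dyck-filter K zero    B h = trans (length-filter-const (h <? K) (dyck h B))
  (cong (λ x → if does (h <? K) then x else 0) (dyck-length h B))
dyck-filter K (suc m) B zero    =
  trans (length-filter-map (λ w → height 0 w (suc m) <? K) (true ∷_) (dyck 1 (m + B))) (dyck-filter K m B 1)
dyck-filter K (suc m) B (suc h) = begin
  length (filter P? (map (true ∷_) us ++ map (false ∷_) ds))
    ≡⟨ cong length (filter-++ P? (map (true ∷_) us) (map (false ∷_) ds)) ⟩
  length (filter P? (map (true ∷_) us) ++ filter P? (map (false ∷_) ds))
    ≡⟨ length-++ (filter P? (map (true ∷_) us)) ⟩
  length (filter P? (map (true ∷_) us)) + length (filter P? (map (false ∷_) ds))
    ≡⟨ cong₂ _+_ (trans (length-filter-map P? (true ∷_) us) (dyck-filter K m B (2 + h)))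
                 (trans (length-filter-map P? (false ∷_) ds) (dyck-filter K m B h)) ⟩
  transfers (suc m) (restrict K (ballot B)) (suc h) ∎
  where
  open ≡-Reasoning
  P? : Decidable (λ (w : Word (suc (m + B))) → height (suc h) w (suc m) < K)
  P? w = height (suc h) w (suc m) <? K
  us = dyck (2 + h) (m + B)
  ds = dyck h (m + B)

dyck-below : ∀ K m B → length (filter (λ w → height 0 w m <? K) (dyck 0 (m + B))) ≡ below m B K
dyck-below K m B = begin
  length (filter (λ w → height 0 w m <? K) (dyck 0 (m + B)))
    ≡⟨ dyck-filter K m B 0 ⟩
  transfers m φ 0
    ≡⟨ transfers-at-0 m φ (m + K) (m≤m+n m K) ⟩
  sum< (suc (m + K)) (λ x → ballot m x * φ x)
    ≡⟨ sum<-stable (λ x → ballot m x * φ x) (m≤n⇒m≤1+n (m≤n+m K m)) outside ⟩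
  sum< K (λ x → ballot m x * φ x)
    ≡⟨ sum<-cong K inside ⟩
  below m B K ∎
  where
  open ≡-Reasoning
  φ = restrict K (ballot B)
  outside : ∀ x → K ≤ x → ballot m x * φ x ≡ 0
  outside x K≤x = trans (cong (λ b → ballot m x * (if b then ballot B x else 0)) (dec-false (x <? K) (≤⇒≯ K≤x)))
    (*-zeroʳ (ballot m x))
  inside : ∀ x → x < K → ballot m x * φ x ≡ through m B x
  inside x x<K = cong (λ b → ballot m x * (if b then ballot B x else 0)) (dec-true (x <? K) x<K)

-- The list of linear extensions

concatMap-cartesian : ∀ {A B C : Set} (f : A → B → C) xs ys → concatMap (λ x → map (f x) ys) xs ≡ cartesianProductWith f xs ys
concatMap-cartesian f []       ys = refl
concatMap-cartesian f (x ∷ xs) ys = cong (map (f x) ys ++_) (concatMap-cartesian f xs ys)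

allVecs-unique : ∀ k m → Unique (allVecs k m)
allVecs-unique zero    m = All.[] ∷ []
allVecs-unique (suc k) m = subst Unique (sym (concatMap-cartesian _∷_ (allFin m) (allVecs k m)))
  (Unique.cartesianProductWith⁺ _∷_ Vec.∷-injective (Unique.allFin⁺ m) (allVecs-unique k m))

allVecs-complete : ∀ k m (v : Vec (Fin m) k) → v ∈ allVecs k m
allVecs-complete zero    m []      = here refl
allVecs-complete (suc k) m (x ∷ v) = subst (x ∷ v ∈_) (sym (concatMap-cartesian _∷_ (allFin m) (allVecs k m)))
  (∈-cartesianProductWith⁺ _∷_ (∈-allFin x) (allVecs-complete k m v))

∈-linExts⁺ : ∀ n (v : Map n) → IsLinExt {n} v → v ∈ linExts n
∈-linExts⁺ n v ext = ∈-filter⁺ (isLinExt? {n}) (allVecs-complete (2 * n) (2 * n) v) ext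

∈-linExts⁻ : ∀ n (v : Map n) → v ∈ linExts n → IsLinExt {n} v
∈-linExts⁻ n v v∈ = proj₂ (∈-filter⁻ (isLinExt? {n}) {v = v} {xs = allVecs (2 * n) (2 * n)} v∈)

linExts-unique : ∀ n → Unique (linExts n)
linExts-unique n = Unique.filter⁺ (isLinExt? {n}) (allVecs-unique (2 * n) (2 * n))

-- The bijection between linear extensions and Dyck words

pattern top    = zero
pattern bottom = suc zero

letter : Fin 2 → Bool
letter top    = true
letter bottom = false

letter-injective : ∀ {i i′} → letter i ≡ letter i′ → i ≡ i′
letter-injective {top}    {top}    _ = refl
letter-injective {bottom} {bottom} _ = refl
letter-injective {top}    {bottom} ()
letter-injective {bottom} {top}    ()

letter-surjective : ∀ b → ∃[ i ] letter i ≡ b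
letter-surjective true  = top , refl
letter-surjective false = bottom , refl

hit-≢ : ∀ {b b′} → b ≢ b′ → hit b b′ ≡ 0
hit-≢ {true}  {true}  ≢ = contradiction refl ≢
hit-≢ {true}  {false} ≢ = refl
hit-≢ {false} {true}  ≢ = refl
hit-≢ {false} {false} ≢ = contradiction refl ≢

Reads : ∀ {n} → Map n → Word (2 * n) → Set
Reads {n} v w = ∀ i j → lookup w (app n v (i , j)) ≡ letter i

readWord : ∀ n → Map n → Word (2 * n)
readWord n v = tabulate λ k → not (does (any? λ j → app n v (bottom , j) ≟F k))

module _ (n : ℕ) (v : Map n) (ext : IsLinExt {n} v) where

  private
    injective : ∀ x y → app n v x ≡ app n v y → x ≡ y
    injective = proj₁ (proj₁ ext)

    surjective : ∀ k → ∃[ x ] app n v x ≡ k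
    surjective = proj₂ (proj₁ ext)

    label : Cell n → ℕ
    label x = toℕ (app n v x)

    increasing : ∀ i {j j′} → toℕ j < toℕ j′ → label (i , j) < label (i , j′)
    increasing i {j} {j′} j<j′ = ≤∧≢⇒< (proj₂ ext (i , j) (i , j′) (≤-refl , <⇒≤ j<j′)) λ eq →
      <-irrefl (cong (toℕ ∘ proj₂) (injective (i , j) (i , j′) (toℕ-injective eq))) j<j′

  readWord-reads : Reads {n} v (readWord n v)
  readWord-reads top    j = trans (Vec.lookup∘tabulate _ (app n v (top , j)))
    (cong not (dec-false (any? _) λ (j′ , eq) → case-rows (injective (bottom , j′) (top , j) eq)))
    where
    case-rows : ∀ {j j′ : Fin n} → _≢_ {A = Cell n} (bottom , j′) (top , j)
    case-rows ()
  readWord-reads bottom j = trans (Vec.lookup∘tabulate _ (app n v (bottom , j)))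
    (cong not (dec-true (any? _) (j , refl)))

  module _ (w : Word (2 * n)) (reads : Reads {n} v w) where

    Separates : Fin 2 → ℕ → ℕ → Set
    Separates i p c = c ≤ n × (∀ j → (toℕ j < c → label (i , j) < p) × (c ≤ toℕ j → p ≤ label (i , j)))

    -- Invariant of a scan through the labels: the cells of row `i` labelled below `p` form an
    -- initial segment, and its length is the letter count of the word.
    Inv : Fin 2 → ℕ → Set
    Inv i p = Separates i p (count (letter i) w p)

    private
      -- The cell labelled p decides. In row i it must be column c, because labels increase along
      -- the row and exactly the earlier columns are used up. In the other row the threshold of row
      -- i stays.
      next : ∀ i p → p < 2 * n → Inv i p → Inv i (suc p)
      next i p p<2n (c≤n , inv) with surjective (fromℕ< p<2n)
      ... | (i′ , j*) , eq with i ≟F i′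
      ...   | yes refl = subst (Separates i (suc p)) (sym count-at) (subst (_≤ n) (cong suc j*≡c) (toℕ<n j*) , λ j → before j , after j)
        where
        c = count (letter i) w p
        label≡p : label (i , j*) ≡ p
        label≡p = trans (cong toℕ eq) (toℕ-fromℕ< p<2n)
        count-at : count (letter i) w (suc p) ≡ suc c
        count-at = subst (λ x → count (letter i) w (suc x) ≡ suc (count (letter i) w x)) label≡p
          (count-next (letter i) w (app n v (i , j*)) (reads i j*))
        c≤j* : c ≤ toℕ j*
        c≤j* = ≮⇒≥ λ lt → <-irrefl label≡p (proj₁ (inv j*) lt)
        j*≤c : toℕ j* ≤ c
        j*≤c = ≮⇒≥ λ c<j* → let c<n = <-trans c<j* (toℕ<n j*) in
          <⇒≱ (subst (label (i , fromℕ< c<n) <_) label≡p (increasing i (subst (_< toℕ j*) (sym (toℕ-fromℕ< c<n)) c<j*)))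
            (proj₂ (inv (fromℕ< c<n)) (≤-reflexive (sym (toℕ-fromℕ< c<n))))
        j*≡c : toℕ j* ≡ c
        j*≡c = ≤-antisym j*≤c c≤j*
        before : ∀ j → toℕ j < suc c → label (i , j) < suc p
        before j j<1+c with m≤n⇒m<n∨m≡n (s≤s⁻¹ j<1+c)
        ... | inj₁ j<c = m≤n⇒m≤1+n (proj₁ (inv j) j<c)
        ... | inj₂ j≡c with refl ← toℕ-injective (trans j≡c (sym j*≡c)) = s≤s (≤-reflexive label≡p)
        after : ∀ j → suc c ≤ toℕ j → suc p ≤ label (i , j)
        after j c<j = subst (_< label (i , j)) label≡p (increasing i (subst (_< toℕ j) (sym j*≡c) c<j))
      ...   | no i≢i′ = subst (Separates i (suc p)) (sym count-at) (c≤n , λ j →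
              (λ j<c → m≤n⇒m≤1+n (proj₁ (inv j) j<c)) ,
              (λ c≤j → ≤∧≢⇒< (proj₂ (inv j) c≤j) λ p≡ →
                i≢i′ (cong proj₁ (injective (i , j) (i′ , j*) (toℕ-injective (trans (sym p≡) (sym label≡p)))))))
        where
        label≡p : label (i′ , j*) ≡ p
        label≡p = trans (cong toℕ eq) (toℕ-fromℕ< p<2n)
        count-at : count (letter i) w (suc p) ≡ count (letter i) w p
        count-at = subst (λ x → count (letter i) w (suc x) ≡ count (letter i) w x) label≡p
          (trans (count-suc (letter i) w (app n v (i′ , j*)))
            (cong (_+ count (letter i) w (label (i′ , j*))) (trans (cong (hit (letter i)) (reads i′ j*)) (hit-≢ (i≢i′ ∘ letter-injective)))))

    reads-inv : ∀ i p → p ≤ 2 * n → Inv i p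
    reads-inv i zero    _    = z≤n , λ j → (λ ()) , λ _ → z≤n
    reads-inv i (suc p) p<2n = next i p p<2n (reads-inv i p (<⇒≤ p<2n))

    -- Column j lies outside the initial segment at its own label and inside it one label later.
    reads-count : ∀ i j → count (letter i) w (label (i , j)) ≡ toℕ j
    reads-count i j = ≤-antisym
      (≮⇒≥ λ lt → <-irrefl refl (proj₁ (proj₂ (reads-inv i (label (i , j)) (<⇒≤ (toℕ<n _))) j) lt))
      (≮⇒≥ λ lt → <-irrefl refl (proj₂ (proj₂ (reads-inv i (suc (label (i , j))) (toℕ<n _)) j)
        (subst (_≤ toℕ j) (sym (count-next (letter i) w _ (reads i j))) lt)))

    reads-full : ∀ i → count (letter i) w (2 * n) ≡ n
    reads-full i with reads-inv i (2 * n) ≤-refl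
    ... | c≤n , inv = ≤-antisym c≤n (≮⇒≥ λ c<n →
      <⇒≱ (toℕ<n (app n v (i , fromℕ< c<n))) (proj₂ (inv (fromℕ< c<n)) (≤-reflexive (sym (toℕ-fromℕ< c<n)))))

    reads-Dyck : Dyck 0 w
    reads-Dyck = (λ p p≤2n → prefix p (reads-inv top p p≤2n) (reads-inv bottom p p≤2n)) ,
                 trans (reads-full bottom) (sym (reads-full top))
      where
      prefix : ∀ p → Inv top p → Inv bottom p → count false w p ≤ count true w p
      -- If down-steps prevailed, the column numbered by the up-steps would have its bottom cell
      -- labelled below p and its top cell not, against the order.
      prefix p (_ , inv₀) (c₁≤n , inv₁) = ≮⇒≥ λ c₀<c₁ →
        let c₀<n = ≤-trans c₀<c₁ c₁≤n
            j    = fromℕ< c₀<n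
            j≡   = toℕ-fromℕ< c₀<n
        in <⇒≱ (proj₁ (inv₁ j) (subst (_< count false w p) (sym j≡) c₀<c₁))
             (≤-trans (proj₂ (inv₀ j) (≤-reflexive (sym j≡))) (proj₂ ext (top , j) (bottom , j) (z≤n , ≤-refl)))

    reads-readWord : readWord n v ≡ w
    reads-readWord = trans (sym (Vec.tabulate∘lookup (readWord n v)))
      (trans (Vec.tabulate-cong same) (Vec.tabulate∘lookup w))
      where
      same : ∀ k → lookup (readWord n v) k ≡ lookup w k
      same k with surjective k
      ... | (i , j) , refl = trans (readWord-reads i j) (sym (reads i j))

app-ext : ∀ n (v v′ : Map n) → (∀ x → app n v x ≡ app n v′ x) → v ≡ v′
app-ext n v v′ eq = trans (sym (Vec.tabulate∘lookup v)) (trans (Vec.tabulate-cong same) (Vec.tabulate∘lookup v′))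
  where
  same : ∀ k → lookup v k ≡ lookup v′ k
  same k = subst (λ k → lookup v k ≡ lookup v′ k) (combine-remQuot {2} n k) (eq (remQuot {2} n k))

-- The label of (i , j) is the position of the `letter i` preceded by j others, so the word
-- determines it.
readWord-injective : ∀ n (v v′ : Map n) → IsLinExt {n} v → IsLinExt {n} v′ → readWord n v ≡ readWord n v′ → v ≡ v′
readWord-injective n v v′ ext ext′ eq = app-ext n v v′ λ (i , j) →
  position-unique (letter i) (readWord n v) _ _ (readWord-reads n v ext i j) (reads′ i j)
    (trans (reads-count n v ext (readWord n v) (readWord-reads n v ext) i j) (sym (reads-count n v′ ext′ (readWord n v) reads′ i j)))
  where
  reads′ : Reads {n} v′ (readWord n v)
  reads′ = subst (Reads {n} v′) (sym eq) (readWord-reads n v′ ext′)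

module _ (n : ℕ) (w : Word (2 * n)) (dyck-w : Dyck 0 w) where

  private
    balance : count true w (2 * n) ≡ n
    balance = *-cancelˡ-≡ _ _ 2 (trans (cong (count true w (2 * n) +_) (trans (+-identityʳ _) (sym (proj₂ dyck-w))))
      (count-total w (2 * n) ≤-refl))

    full : ∀ i → count (letter i) w (2 * n) ≡ n
    full top    = balance
    full bottom = trans (proj₂ dyck-w) balance

    place : (x : Cell n) → ∃[ p ] (lookup w p ≡ letter (proj₁ x) × count (letter (proj₁ x)) w (toℕ p) ≡ toℕ (proj₂ x))
    place (i , j) = position (letter i) w (toℕ j) (subst (toℕ j <_) (sym (full i)) (toℕ<n j))

    labelling : Map n
    labelling = tabulate (λ k → proj₁ (place (remQuot {2} n k)))

    app-labelling : ∀ x → app n labelling x ≡ proj₁ (place x)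
    app-labelling (i , j) = trans (Vec.lookup∘tabulate _ (combine i j)) (cong (proj₁ ∘ place) (remQuot-combine i j))

    injective : ∀ x y → proj₁ (place x) ≡ proj₁ (place y) → x ≡ y
    injective x@(i , j) y@(i′ , j′) eq
      with refl ← letter-injective {i} {i′} (trans (sym (proj₁ (proj₂ (place x)))) (trans (cong (lookup w) eq) (proj₁ (proj₂ (place y)))))
      = cong (i ,_) (toℕ-injective (trans (sym (proj₂ (proj₂ (place x)))) (trans (cong (count (letter i) w ∘ toℕ) eq) (proj₂ (proj₂ (place y))))))

    surjective : ∀ k → ∃[ x ] proj₁ (place x) ≡ k
    surjective k with letter-surjective (lookup w k)
    ... | i , eq = (i , fromℕ< c<n) , position-unique (letter i) w _ k (proj₁ (proj₂ (place (i , fromℕ< c<n)))) (sym eq)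
                     (trans (proj₂ (proj₂ (place (i , fromℕ< c<n)))) (toℕ-fromℕ< c<n))
      where
      c<n : count (letter i) w (toℕ k) < n
      c<n = subst (count (letter i) w (toℕ k) <_) (full i)
        (≤-trans (≤-reflexive (sym (count-next (letter i) w k (sym eq)))) (count-mono-≤ (letter i) w (toℕ<n k)))

    ordered : ∀ x y → _≼_ {n} x y → toℕ (proj₁ (place x)) ≤ toℕ (proj₁ (place y))
    ordered x@(i , j) y@(i′ , j′) (i≤i′ , j≤j′) with place x | place y
    ... | p , wp , cp | p′ , wp′ , cp′ = ≮⇒≥ (go i i′ i≤i′ wp cp wp′ cp′)
      where
      go : ∀ i i′ → toℕ i ≤ toℕ i′ → lookup w p ≡ letter i → count (letter i) w (toℕ p) ≡ toℕ j →
        lookup w p′ ≡ letter i′ → count (letter i′) w (toℕ p′) ≡ toℕ j′ → ¬ (toℕ p′ < toℕ p)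
      same : ∀ b → count b w (toℕ p) ≡ toℕ j → lookup w p′ ≡ b → count b w (toℕ p′) ≡ toℕ j′ → ¬ (toℕ p′ < toℕ p)
      same b cp wp′ cp′ p′<p = <⇒≱ (subst₂ _<_ cp′ cp (count-strict b w p′ p wp′ p′<p)) j≤j′
      go top    top    _ wp cp wp′ cp′ = same true cp wp′ cp′
      go bottom bottom _ wp cp wp′ cp′ = same false cp wp′ cp′
      -- If p′ < p, the prefix before p has at least j′ + 1 down-steps but only j up-steps, so the
      -- Dyck condition would give j′ < j.
      go top    bottom _ wp cp wp′ cp′ p′<p = <⇒≱
        (≤-trans (≤-reflexive (trans (cong suc (sym cp′)) (sym (count-next false w p′ wp′))))
          (≤-trans (count-mono-≤ false w p′<p)
            (≤-trans (proj₁ dyck-w (toℕ p) (<⇒≤ (toℕ<n p))) (≤-reflexive cp)))) j≤j′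

  Dyck⇒linExt : ∃[ v ] (IsLinExt {n} v × readWord n v ≡ w)
  Dyck⇒linExt = labelling , ext , reads-readWord n labelling ext w λ i j →
      trans (cong (lookup w) (app-labelling (i , j))) (proj₁ (proj₂ (place (i , j))))
    where
    ext : IsLinExt {n} labelling
    ext = ((λ x y eq → injective x y (trans (sym (app-labelling x)) (trans eq (app-labelling y)))) ,
           (λ k → proj₁ (surjective k) , trans (app-labelling _) (proj₂ (surjective k)))) ,
          (λ x y x≼y → subst₂ (λ p q → toℕ p ≤ toℕ q) (sym (app-labelling x)) (sym (app-labelling y)) (ordered x y x≼y))

linExt-dyck : ∀ n v → IsLinExt {n} v → readWord n v ∈ dyck 0 (2 * n)
linExt-dyck n v ext = ∈-dyck⁺ 0 (readWord n v) (reads-Dyck n v ext (readWord n v) (readWord-reads n v ext))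

-- Duplicate-free lists with the same members are permutations of each other, which carries every
-- count over to words.
linExts-dyck : ∀ n → map (readWord n) (linExts n) ↭ dyck 0 (2 * n)
linExts-dyck n = ∼bag⇒↭ (unique∧set⇒bag
  (map-unique (readWord n) (linExts n) (λ {v} {v′} v∈ v′∈ → readWord-injective n v v′ (∈-linExts⁻ n v v∈) (∈-linExts⁻ n v′ v′∈)) (linExts-unique n))
  (dyck-unique 0 (2 * n)) (mk⇔ to from))
  where
  to′ : ∀ {w} → ∃[ v ] (v ∈ linExts n × w ≡ readWord n v) → w ∈ dyck 0 (2 * n)
  to′ (v , v∈ , refl) = linExt-dyck n v (∈-linExts⁻ n v v∈)
  to : ∀ {w} → w ∈ map (readWord n) (linExts n) → w ∈ dyck 0 (2 * n)
  to w∈ = to′ (∈-map⁻ (readWord n) w∈)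
  from′ : ∀ {w} → ∃[ v ] (IsLinExt {n} v × readWord n v ≡ w) → w ∈ map (readWord n) (linExts n)
  from′ (v , ext , refl) = ∈-map⁺ (readWord n) (∈-linExts⁺ n v ext)
  from : ∀ {w} → w ∈ dyck 0 (2 * n) → w ∈ map (readWord n) (linExts n)
  from {w} w∈ = from′ (Dyck⇒linExt n w (∈-dyck⁻ 0 w w∈))

numLinExt-catalan : ∀ n → numLinExt n ≡ catalan n
numLinExt-catalan n = begin
  length (linExts n)                    ≡⟨ length-map (readWord n) (linExts n) ⟨
  length (map (readWord n) (linExts n)) ≡⟨ ↭-length (linExts-dyck n) ⟩
  length (dyck 0 (2 * n))               ≡⟨ dyck-length 0 (2 * n) ⟩
  ballot (2 * n) 0                      ≡⟨ cong (λ l → ballot (n + l) 0) (+-identityʳ n) ⟩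
  catalan n                             ∎
  where open ≡-Reasoning

-- With α = β + h and m = α + β + 1, the cell (bottom , β) precedes (top , α) iff at most α
-- of the first m labels lie in the top row, that is, iff the path has height ≤ h at time m.
module _ (n : ℕ) (α β : Fin n) (h m : ℕ) (α≡ : toℕ α ≡ toℕ β + h) (m≡ : m ≡ 1 + (2 * toℕ β + h)) (m≤2n : m ≤ 2 * n) where

  precedes : ∀ v → IsLinExt {n} v →
    toℕ (app n v (bottom , β)) ≤ toℕ (app n v (top , α)) ⇔ height 0 (readWord n v) m < suc h
  precedes v ext = mk⇔ to from
    where
    w = readWord n v
    reads = readWord-reads n v ext
    a = count true w m
    b = count false w m
    inv-top = proj₂ (reads-inv n v ext w reads top m m≤2n) α
    inv-bottom = proj₂ (reads-inv n v ext w reads bottom m m≤2n) β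
    total : a + b ≡ 1 + (2 * toℕ β + h)
    total = trans (count-total w m m≤2n) m≡
    height≡ : height 0 w m + b ≡ a
    height≡ = height-count 0 w (linExt-dyck n v ext) m
    to : toℕ (app n v (bottom , β)) ≤ toℕ (app n v (top , α)) → height 0 w m < suc h
    to le = difference-small h a b (height 0 w m) (toℕ β) (subst (a ≤_) α≡ (≮⇒≥ few)) total height≡
      where
      few : ¬ (toℕ α < a)
      few α<a = <⇒≱ (counts-exceed h a b (toℕ β) (subst (_< a) α≡ α<a)
        (≰⇒> λ b≤β → <⇒≱ (proj₁ inv-top α<a) (≤-trans (proj₂ inv-bottom b≤β) le))) (≤-reflexive total)
    from : height 0 w m < suc h → toℕ (app n v (bottom , β)) ≤ toℕ (app n v (top , α))
    from lt = ≤-trans (<⇒≤ (proj₁ inv-bottom (≰⇒> (λ b≤β → <⇒≱ (counts-fall-short h a b (toℕ β) a≤α b≤β) (≤-reflexive (sym total))))))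
                      (proj₂ inv-top (subst (a ≤_) (sym α≡) a≤α))
      where
      a≤α : a ≤ toℕ β + h
      a≤α = difference-small⁻¹ h a b (height 0 w m) (toℕ β) lt total height≡

-- From precedence counts to the sorting probability

numBefore-below : ∀ n (α β : Fin n) h m B → toℕ α ≡ toℕ β + h → m ≡ 1 + (2 * toℕ β + h) → m + B ≡ 2 * n →
  numBefore n (bottom , β) (top , α) ≡ below m B (suc h)
numBefore-below n α β h m B α≡ m≡ mB≡ = trans
  (length-filter-transport (λ v → toℕ (app n v (bottom , β)) ≤? toℕ (app n v (top , α))) (λ w → height 0 w m <? suc h)
    (readWord n) (linExts n) (dyck 0 (2 * n)) (linExts-dyck n)
    (λ {v} v∈ → precedes n α β h m α≡ m≡ (subst (m ≤_) mB≡ (m≤m+n m B)) v (∈-linExts⁻ n v v∈)))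
  (trans (cong (λ l → length (filter (λ w → height 0 w m <? suc h) (dyck 0 l))) (sym mB≡)) (dyck-below (suc h) m B))

numBefore-complement : ∀ n {x y : Cell n} → x ≢ y → numBefore n x y + numBefore n y x ≡ catalan n
numBefore-complement n {x} {y} x≢y = trans
  (length-filter-complement (λ v → toℕ (app n v x) ≤? toℕ (app n v y)) (λ v → toℕ (app n v y) ≤? toℕ (app n v x)) (linExts n)
    (λ {v} v∈ → opposite v (∈-linExts⁻ n v v∈)))
  (numLinExt-catalan n)
  where
  opposite : ∀ v → IsLinExt {n} v → toℕ (app n v y) ≤ toℕ (app n v x) ⇔ (¬ (toℕ (app n v x) ≤ toℕ (app n v y)))
  opposite v ext = mk⇔ (λ ge le → x≢y (proj₁ (proj₁ ext) x y (toℕ-injective (≤-antisym le ge)))) (<⇒≤ ∘ ≰⇒>)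

-- The columns β = c + i and α = β + g + 1 solve α + β + 1 = n + 2i and α - β + 1 = g + 2, so
-- `slice n g i` counts the extensions placing (bottom , β) first.
balanced-pair : ∀ K n → Balanced K n → ∃[ x ] ∃[ y ] (x ≢ y × bias n x y ^ 4 * n ^ 5 ≤ K * numLinExt n ^ 4)
balanced-pair K n bal = (bottom , β) , (top , α) , rows , subst₂ (λ d e → d ^ 4 * n ^ 5 ≤ K * e ^ 4) (sym bias≡) (sym (numLinExt-catalan n)) bound
  where
  open Balanced bal
  rows : _≢_ {A = Cell n} (bottom , _) (top , _)
  rows ()
  α<n : c + i + suc g < n
  α<n = column-bound n g c i n≡k+2c i≤c
  β<n : c + i < n
  β<n = ≤-<-trans (m≤m+n (c + i) (suc g)) α<n
  α = fromℕ< α<n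
  β = fromℕ< β<n
  total : n + 2 * i + (n ∸ 2 * i) ≡ 2 * n
  total = trans (+-assoc n (2 * i) (n ∸ 2 * i)) (trans (cong (n +_) (m+[n∸m]≡n (shift-bound n g c i n≡k+2c i≤c))) (cong (n +_) (sym (+-identityʳ n))))
  before : numBefore n (bottom , β) (top , α) ≡ slice n g i
  before = numBefore-below n α β (suc g) (n + 2 * i) (n ∸ 2 * i)
    (trans (toℕ-fromℕ< α<n) (cong (_+ suc g) (sym (toℕ-fromℕ< β<n))))
    (trans (slice-time n g c i n≡k+2c) (cong (λ b → 1 + (2 * b + suc g)) (sym (toℕ-fromℕ< β<n)))) total
  bias≡ : bias n (bottom , β) (top , α) ≡ catalan n ∸ 2 * slice n g i
  bias≡ = trans (cong (∣_- numBefore n (top , α) (bottom , β) ∣) before)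
    (remainder-dist (slice n g i) (numBefore n (top , α) (bottom , β)) (catalan n)
      (trans (cong (_+ numBefore n (top , α) (bottom , β)) (sym before)) (numBefore-complement n {bottom , β} {top , α} rows)) lower)

-- Fourth powers clear the fractional exponent: the inequality says that `bias` divided by
-- `numLinExt` is at most K^(1/4) n^(-5/4). One such pair bounds the minimum over all pairs.
theorem1p1 : ∃[ K ] ((0 < K) × ∃[ N ] (∀ (n : ℕ) → N ≤ n →
    ∃[ x ] ∃[ y ] ((x ≢ y) × ((bias n x y ^ 4) * (n ^ 5) ≤ K * (numLinExt n ^ 4)))))
theorem1p1 = 16 ^ 5 * (48 * 128) ^ 4 , ≤ᵇ⇒≤ 1 (16 ^ 5 * (48 * 128) ^ 4) _ , fourth (416 * 128) , λ n large →
  let r , R≤r , r⁴≤n , n≤16r⁴ = fourth-root (416 * 128) n (≤ᵇ⇒≤ 1 (416 * 128) _) large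
  in balanced-pair (16 ^ 5 * (48 * 128) ^ 4) n (balanced-exists n r R≤r r⁴≤n n≤16r⁴)
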